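{- Let $q,\alpha_1,\alpha_2,\alpha_3\in\mathbb{Q}$ with $q<0$, $\alpha_1\notin[-2,0]$, $\alpha_2\in(-2,0)$ and $\alpha_3<-1$. Suppose that $T^-$ and $T^+$ satisfy $0<T^-\le T^+$. Given a target edge-weight $T^*\in[T^-,T^+]$ and a positive value $\pi$ which is sufficiently small with respect to $q,\alpha_1,\alpha_2,\alpha_3,T^-,T^+$, there is a planar graph $\Upsilon$ (depending on $T^*$ and $\pi$) and a weight function $\widehat w:E(\Upsilon)\to\{\alpha_1,\alpha_2,\alpha_3\}$ that implements a weight $w^*$ with $T^*-\pi\le w^*\le T^*$. The size of $\Upsilon$ is at most a polynomial in $\log(\pi^{ -1})$.
   Context: Graphs are finite and may have loops and multiple edges. The number $q$ is fixed. A planar graph $\Upsilon$ with distinct distinguished vertices $s,t$ on the outer face and weights $\widehat w:E(\Upsilon)\to\mathbb{Q}$ implements the weight $w^*$ if $Z_{s|t}(\Upsilon)\ne0$ and $w^*=qZ_{st}(\Upsilon)/Z_{s|t}(\Upsilon)$. Here $Z_{st}(\Upsilon)$ (resp. $Z_{s|t}(\Upsilon)$) is the sum of $\big(\prod_{e\in A}\widehat w(e)\big)q^{\kappa(V(\Upsilon),A)}$ over all $A\subseteq E(\Upsilon)$ such that $s,t$ are in the same component (resp. different components) of $(V(\Upsilon),A)$, and $\kappa(V(\Upsilon),A)$ is the number of connected components of $(V(\Upsilon),A)$. The polynomial in the size bound may depend on $q,\alpha_1,\alpha_2,\alpha_3,T^-,T^+$ but not on $\pi$ or $T^*$. -}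

module Defs where

open import Algebra.Definitions.RawSemiring using () renaming (_^_ to power)
open import Data.Bool.Base using (Bool; true; false; not)
open import Data.Empty using (⊥-elim)
open import Data.Fin.Base using (Fin; zero; suc; punchIn; punchOut)
open import Data.Fin.Properties using (_≟_; all?; punchOut-cong; punchOut-injective; punchOut-punchIn; punchInᵢ≢i)
open import Data.Fin.Subset using (Subset; inside; outside; _∈_)
open import Data.Fin.Subset.Properties using (_∈?_)
open import Data.Integer.Base using (+_)
open import Data.List.Base using (List; []; _∷_; _++_; map; filter; foldr; length; allFin)
open import Data.Nat.Base as ℕ using (ℕ; zero; suc)
open import Data.Nat.GeneralisedArithmetic using (iterate)
open import Data.Product.Base using (Σ; ∃; _×_; _,_; proj₁; proj₂)
open import Data.Rational.Base as ℚ using (ℚ; 0ℚ; 1ℚ; _/_; ∣_∣; +-*-rawSemiring; ≢-nonZero)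
import Data.Rational.Properties as ℚ
open import Data.Rational.Solver using (module +-*-Solver)
open import Data.Vec.Base using ([]; _∷_; here; there)
open import Function.Base using (_∘_)
open import Function.Bundles using (_↔_; _⇔_; Inverse)
open import Level using (0ℓ)
open import Relation.Binary.Construct.Closure.Equivalence as Eq using (EqClosure)
open import Relation.Binary.Core using (Rel)
open import Relation.Binary.Definitions using (Decidable)
open import Relation.Binary.PropositionalEquality
open import Relation.Nullary using (¬_; ¬?; Dec; yes; no)
open import Relation.Nullary.Decidable using (map′; _×-dec_)

-- Real numbers, as regular Cauchy sequences of rationals (Bishop)

1/suc : ℕ → ℚ
1/suc n = + 1 / suc n

record ℝ : Set where
  constructor mkℝ
  field
    approx  : ℕ → ℚ
    regular : ∀ m n → ∣ approx m ℚ.- approx n ∣ ℚ.≤ 1/suc m ℚ.+ 1/suc n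

open ℝ public

infix 4 _≤ᴿ_ _<ᴿ_
infixl 6 _-ᴿ_

-- As approx x n is within 1/(n+1) of x, a term 2/(n+1) absorbs the errors on
-- both sides.

_≤ᴿ_ : Rel ℝ 0ℓ
x ≤ᴿ y = ∀ n → approx x n ℚ.≤ approx y n ℚ.+ (1/suc n ℚ.+ 1/suc n)

_<ᴿ_ : Rel ℝ 0ℓ
x <ᴿ y = ∃ λ n → approx x n ℚ.+ (1/suc n ℚ.+ 1/suc n) ℚ.< approx y n

private
  0≤1/suc : ∀ n → 0ℚ ℚ.≤ 1/suc n
  0≤1/suc n = ℚ.nonNegative⁻¹ (1/suc n) {{ℚ.normalize-nonNeg 1 (suc n)}}

fromℚ : ℚ → ℝ
approx  (fromℚ r) _   = r
regular (fromℚ r) m n = begin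
  ∣ r ℚ.- r ∣               ≡⟨ cong ∣_∣ (ℚ.+-inverseʳ r) ⟩
  0ℚ ℚ.+ 0ℚ                 ≤⟨ ℚ.+-mono-≤ (0≤1/suc m) (0≤1/suc n) ⟩
  1/suc m ℚ.+ 1/suc n       ∎
  where open ℚ.≤-Reasoning

private
  double : ℕ → ℕ
  double n = suc (n ℕ.+ n)

  halves : ∀ n → 1/suc (double n) ℚ.+ 1/suc (double n) ≡ 1/suc n
  halves n = ℚ.toℚᵘ-injective (begin
    toℚᵘ (1/suc (double n) ℚ.+ 1/suc (double n))
      ≈⟨ ℚ.toℚᵘ-homo-+ (1/suc (double n)) (1/suc (double n)) ⟩
    toℚᵘ (1/suc (double n)) ℚᵘ.+ toℚᵘ (1/suc (double n))
      ≈⟨ ℚᵘ.+-cong (ℚ.toℚᵘ-fromℚᵘ (mkℚᵘ (+ 1) (double n))) (ℚ.toℚᵘ-fromℚᵘ (mkℚᵘ (+ 1) (double n))) ⟩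
    mkℚᵘ (+ 1) (double n) ℚᵘ.+ mkℚᵘ (+ 1) (double n)
      ≈⟨ ℚᵘ.*≡* (cong +_ (S.solve 1
           (λ k → ((S.con 1 S.:* (S.con 2 S.:+ (k S.:+ k)) S.:+ S.con 1 S.:* (S.con 2 S.:+ (k S.:+ k))) S.:* (S.con 1 S.:+ k))
             S.:= S.con 1 S.:* ((S.con 2 S.:+ (k S.:+ k)) S.:* (S.con 2 S.:+ (k S.:+ k)))) refl n)) ⟩
    mkℚᵘ (+ 1) n
      ≈⟨ ℚᵘ.≃-sym (ℚ.toℚᵘ-fromℚᵘ (mkℚᵘ (+ 1) n)) ⟩
    toℚᵘ (1/suc n) ∎)
    where
    open import Data.Rational.Unnormalised.Base as ℚᵘ using (mkℚᵘ)
    import Data.Rational.Unnormalised.Properties as ℚᵘ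
    open import Data.Nat.Solver using () renaming (module +-*-Solver to S)
    open import Data.Rational.Base using (toℚᵘ)
    open ℚᵘ.≃-Reasoning

_-ᴿ_ : ℝ → ℝ → ℝ
approx  (x -ᴿ y) n   = approx x (double n) ℚ.- approx y (double n)
regular (x -ᴿ y) m n = begin
  ∣ (a ℚ.- b) ℚ.- (c ℚ.- d) ∣
    ≡⟨ cong ∣_∣ (solve 4 (λ a b c d → (a :- b) :- (c :- d) := (a :- c) :- (b :- d)) refl a b c d) ⟩
  ∣ (a ℚ.- c) ℚ.- (b ℚ.- d) ∣
    ≤⟨ ℚ.∣p-q∣≤∣p∣+∣q∣ (a ℚ.- c) (b ℚ.- d) ⟩
  ∣ a ℚ.- c ∣ ℚ.+ ∣ b ℚ.- d ∣
    ≤⟨ ℚ.+-mono-≤ (regular x (double m) (double n)) (regular y (double m) (double n)) ⟩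
  (M ℚ.+ N) ℚ.+ (M ℚ.+ N)
    ≡⟨ solve 2 (λ M N → (M :+ N) :+ (M :+ N) := (M :+ M) :+ (N :+ N)) refl M N ⟩
  (M ℚ.+ M) ℚ.+ (N ℚ.+ N)
    ≡⟨ cong₂ ℚ._+_ (halves m) (halves n) ⟩
  1/suc m ℚ.+ 1/suc n ∎
  where
  open ℚ.≤-Reasoning
  open +-*-Solver
  a = approx x (double m)
  b = approx y (double m)
  c = approx x (double n)
  d = approx y (double n)
  M = 1/suc (double m)
  N = 1/suc (double n)

infixr 8 _^_

_^_ : ℚ → ℕ → ℚ
_^_ = power +-*-rawSemiring

-- For x positive, 2⁻ⁿ ≤ x is log₂ (x⁻¹) ≤ n.  The least such n is
-- ⌈log₂ (x⁻¹)⌉, or 0 if x ≥ 1, so a bound by f n for all such n, f monotone,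
-- is a bound by f of that value.

log₂[_⁻¹]≤_ : ℝ → ℕ → Set
log₂[ x ⁻¹]≤ n = fromℚ (ℚ.½ ^ n) ≤ᴿ x

-- Coefficients, constant one first

Polynomial : Set
Polynomial = List ℕ

eval : Polynomial → ℕ → ℕ
eval p x = foldr (λ c r → c ℕ.+ x ℕ.* r) 0 p

record Classes {A : Set} (R : Rel A 0ℓ) (k : ℕ) : Set where
  field
    class      : A → Fin k
    surjective : ∀ c → ∃ λ x → class x ≡ c
    sound      : ∀ {x y} → R x y → class x ≡ class y
    complete   : ∀ {x y} → class x ≡ class y → R x y

-- The order of the two endpoints of an edge carries no meaning.

record Graph : Set where
  field
    #V   : ℕ
    #E   : ℕ
    ends : Fin #E → Fin #V × Fin #V

  Vertex : Set
  Vertex = Fin #V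

  Edge : Set
  Edge = Fin #E

size : Graph → ℕ
size G = #V ℕ.+ #E where open Graph G

Adjacent : ∀ {n m} → (Fin m → Fin n × Fin n) → Subset m → Rel (Fin n) 0ℓ
Adjacent ends A u v = ∃ λ e → e ∈ A × ends e ≡ (u , v)

Connected : (G : Graph) → Subset (Graph.#E G) → Rel (Graph.Vertex G) 0ℓ
Connected G A = EqClosure (Adjacent (Graph.ends G) A)

private
  module _ {n : ℕ} where

    merge : ∀ {k} (i j : Fin (suc k)) → i ≢ j → Fin (suc k) → Fin k
    merge i j i≢j c with i ≟ c
    ... | yes _  = punchOut i≢j
    ... | no i≢c = punchOut i≢c

    merge-punchIn : ∀ {k} (i j : Fin (suc k)) (i≢j : i ≢ j) c →
                    merge i j i≢j (punchIn i c) ≡ c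
    merge-punchIn i j i≢j c with i ≟ punchIn i c
    ... | yes i≡ = ⊥-elim (punchInᵢ≢i i c (sym i≡))
    ... | no  i≢ = trans (punchOut-cong i refl) (punchOut-punchIn i)

    merge-merges : ∀ {k} (i j : Fin (suc k)) (i≢j : i ≢ j) →
                   merge i j i≢j i ≡ merge i j i≢j j
    merge-merges i j i≢j with i ≟ i | i ≟ j
    ... | yes _  | yes i≡j = ⊥-elim (i≢j i≡j)
    ... | yes _  | no _    = punchOut-cong i refl
    ... | no i≢i | _       = ⊥-elim (i≢i refl)

    private
      weaken : ∀ {m b} {ends : Fin (suc m) → Fin n × Fin n} {A : Subset m} {u v} →
               EqClosure (Adjacent (ends ∘ suc) A) u v →
               EqClosure (Adjacent ends (b ∷ A)) u v
      weaken = Eq.map λ (e , e∈A , eq) → suc e , there e∈A , eq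

    classify : ∀ {m} (ends : Fin m → Fin n × Fin n) (A : Subset m) →
               ∃ (Classes (EqClosure (Adjacent ends A)))
    classify {zero} ends [] = n , record
      { class      = λ x → x
      ; surjective = λ c → c , refl
      ; sound      = Eq.fold isEquivalence λ ()
      ; complete   = λ { refl → Eq.reflexive _ }
      }
    classify {suc m} ends (outside ∷ A) with classify (ends ∘ suc) A
    ... | k , C = k , record
      { class      = class
      ; surjective = surjective
      ; sound      = sound ∘ Eq.map λ { (suc e , there e∈A , eq) → e , e∈A , eq }
      ; complete   = weaken ∘ complete
      }
      where open Classes C
    classify {suc m} ends (inside ∷ A) with classify (ends ∘ suc) A
    ... | k , C with Classes.class C (proj₁ (ends zero)) ≟ Classes.class C (proj₂ (ends zero))
    ...   | yes same = k , record
      { class      = class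
      ; surjective = surjective
      ; sound      = Eq.gfold isEquivalence class λ
          { (zero  , _         , eq) → subst (λ p → class (proj₁ p) ≡ class (proj₂ p)) eq same
          ; (suc e , there e∈A , eq) → sound (Eq.return (e , e∈A , eq)) }
      ; complete   = weaken ∘ complete
      }
      where open Classes C
    classify {suc m} ends (inside ∷ A) | zero , C | no _
      with () ← Classes.class C (proj₁ (ends zero))
    classify {suc m} ends (inside ∷ A) | suc k , C | no i≢j = k , record
      { class      = merge i j i≢j ∘ class
      ; surjective = λ c → let x , eq = surjective (punchIn i c) in
                           x , trans (cong (merge i j i≢j) eq) (merge-punchIn i j i≢j c)
      ; sound      = Eq.gfold isEquivalence (merge i j i≢j ∘ class) λ
          { (zero  , _         , eq) →
              subst (λ p → merge i j i≢j (class (proj₁ p)) ≡ merge i j i≢j (class (proj₂ p)))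
                    eq (merge-merges i j i≢j)
          ; (suc e , there e∈A , eq) →
              cong (merge i j i≢j) (sound (Eq.return (e , e∈A , eq))) }
      ; complete   = joined _ _
      }
      where
      open Classes C
      i = class (proj₁ (ends zero))
      j = class (proj₂ (ends zero))
      R = EqClosure (Adjacent ends (inside ∷ A))

      lift : ∀ {x y} → class x ≡ class y → R x y
      lift = weaken ∘ complete

      u~v : R (proj₁ (ends zero)) (proj₂ (ends zero))
      u~v = Eq.return (zero , here , refl)

      _⨾_ : ∀ {x y z} → R x y → R y z → R x z
      _⨾_ = Eq.transitive _

      joined : ∀ x y → merge i j i≢j (class x) ≡ merge i j i≢j (class y) → R x y
      joined x y eq with i ≟ class x | i ≟ class y
      ... | yes p | yes q = lift (trans (sym p) q)
      ... | yes p | no  q = lift (sym p) ⨾ (u~v ⨾ lift (punchOut-injective i≢j q eq))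
      ... | no  p | yes q = lift (punchOut-injective p i≢j eq) ⨾ (Eq.symmetric _ u~v ⨾ lift q)
      ... | no  p | no  q = lift (punchOut-injective p q eq)

components : ∀ G A → ∃ (Classes (Connected G A))
components G A = classify (Graph.ends G) A

κ : ∀ G → Subset (Graph.#E G) → ℕ
κ G A = proj₁ (components G A)

connected? : ∀ G A → Decidable (Connected G A)
connected? G A u v = map′ complete sound (class u ≟ class v)
  where open Classes (proj₂ (components G A))

allEdges : ∀ G → Subset (Graph.#E G)
allEdges G = Data.Fin.Subset.⊤

isolated? : ∀ G (v : Graph.Vertex G) →
            Dec (∀ e → proj₁ (Graph.ends G e) ≢ v × proj₂ (Graph.ends G e) ≢ v)
isolated? G v = all? λ e → ¬? (proj₁ (ends e) ≟ v) ×-dec ¬? (proj₂ (ends e) ≟ v)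
  where open Graph G

#isolated : Graph → ℕ
#isolated G = length (filter (isolated? G) (allFin (Graph.#V G)))

-- Every edge, loops included, consists of two darts (directed half-edges).

Dart : Graph → Set
Dart G = Graph.Edge G × Bool

opposite : ∀ G → Dart G → Dart G
opposite G (e , b) = e , not b

tail : ∀ G → Dart G → Graph.Vertex G
tail G (e , false) = proj₁ (Graph.ends G e)
tail G (e , true)  = proj₂ (Graph.ends G e)

-- On a finite set the forward orbits of a permutation are its cycles.

SameOrbit : {A : Set} → (A → A) → Rel A 0ℓ
SameOrbit f x y = ∃ λ k → iterate f x k ≡ y

-- A rotation system: the permutation "rotation" cyclically orders the darts
-- leaving each vertex, and the facial walks are the orbits of "along".
-- Summed over the connected components, V − E + F is 2κ − 2·(total genus), so
-- Euler's formula below says that every component is drawn on the sphere.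
-- A component that is an isolated vertex has one face but no dart, hence
-- the term #isolated.

record PlaneEmbedding (G : Graph) : Set where
  open Graph G
  field
    rotation   : Dart G ↔ Dart G
    atVertices : ∀ d d′ → tail G d ≡ tail G d′ ⇔ SameOrbit (Inverse.to rotation) d d′

  along : Dart G → Dart G
  along = Inverse.to rotation ∘ opposite G

  field
    #F    : ℕ
    faces : Classes (SameOrbit along) #F
    euler : #V ℕ.+ (#F ℕ.+ #isolated G) ≡ #E ℕ.+ 2 ℕ.* κ G (allEdges G)

-- Any face of a drawing on the sphere can be made the outer one.  Vertices in
-- different components impose no condition, since the components can be drawn
-- side by side, each with an outer face of its own choosing.

OnOuterFace : ∀ {G} → PlaneEmbedding G → Rel (Graph.Vertex G) 0ℓ
OnOuterFace {G} P s t = Connected G (allEdges G) s t →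
  ∃ λ d → ∃ λ d′ → tail G d ≡ s × tail G d′ ≡ t × SameOrbit (PlaneEmbedding.along P) d d′

PlanarWithTerminals : ∀ G → Rel (Graph.Vertex G) 0ℓ
PlanarWithTerminals G s t = s ≢ t × Σ (PlaneEmbedding G) λ P → OnOuterFace P s t

subsets : ∀ m → List (Subset m)
subsets zero    = [] ∷ []
subsets (suc m) = map (outside ∷_) (subsets m) ++ map (inside ∷_) (subsets m)

sum : List ℚ → ℚ
sum = foldr ℚ._+_ 0ℚ

product : List ℚ → ℚ
product = foldr ℚ._*_ 1ℚ

module _ (q : ℚ) (G : Graph) (w : Graph.Edge G → ℚ) where
  open Graph G

  term : Subset #E → ℚ
  term A = product (map w (filter (_∈? A) (allFin #E))) ℚ.* q ^ κ G A

  Z-joined : Vertex → Vertex → ℚ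
  Z-joined s t = sum (map term (filter (λ A → connected? G A s t) (subsets #E)))

  Z-separated : Vertex → Vertex → ℚ
  Z-separated s t = sum (map term (filter (λ A → ¬? (connected? G A s t)) (subsets #E)))

  Implements : Vertex → Vertex → ℚ → Set
  Implements s t w* = Σ (Z-separated s t ≢ 0ℚ) λ nz →
    w* ≡ ℚ._÷_ (q ℚ.* Z-joined s t) (Z-separated s t) {{≢-nonZero nz}}

-- In terms of y = 1 + w, where w is an effective weight, parallel composition
-- is multiplication.  A path of k + 1 edges of weight α₂ has, as q and α₂ are
-- negative, a negative effective weight - drop k, and drop k decays
-- geometrically in k, the ratio drop (k + 1) / drop k being bounded away from
-- 0 and from 1.  Start from parallel edges of weight α₁, where y is an even
-- power of 1 + α₁ that exceeds 1 + T*, and for k = K, K + 1, … add paths of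
-- length k + 1 in parallel, each multiplying y by 1 - drop k, as long as y
-- stays at least the target.  Consecutive factors are comparable, so a bounded
-- number of paths of each length suffices, and the relative error after
-- length k + 1 is drop k.  Hence lengths O(log π⁻¹) suffice, and the size is
-- quadratic in log π⁻¹.  The graph arises from a single edge by doubling
-- edges and subdividing them, and these operations preserve rotation systems
-- of genus 0.

module Submission where

open import Defs
open import Data.Bool.Base using (Bool; true; false; not; if_then_else_)
import Data.Bool.Properties as Bool
open import Data.Empty using (⊥-elim)
open import Data.Fin.Base using (Fin; zero; suc)
open import Data.Fin.Properties using (_≟_; injective⇒≤; suc-injective)
open import Data.Fin.Subset as Subset using (Subset; inside; outside; ⊤)
open import Data.Fin.Subset.Properties using (_∈?_; ∈⊤)
open import Data.Integer.Base as ℤ using (+_; -[1+_])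
import Data.Integer.Properties as ℤ
open import Data.List.Base as List using (List; []; _∷_; _++_; length; filter; allFin)
open import Data.List.Membership.Propositional using (_∈_)
open import Data.List.Properties using (filter-none; map-++; map-∘; map-tabulate)
import Data.List.Relation.Unary.All as All
open import Data.List.Relation.Unary.Any using (here; there)
open import Data.Nat.Base as ℕ using (ℕ; zero; suc)
import Data.Nat.Properties as ℕ
import Data.Nat.Solver as ℕ
open import Data.Product.Base using (Σ; ∃; _×_; _,_; proj₁; proj₂; map)
open import Data.Product.Properties using (≡-dec)
open import Data.Rational.Base as ℚ using (ℚ; 0ℚ; 1ℚ; ½; mkℚ; toℚᵘ; _+_; _*_; _-_; -_; _÷_; _<_; _≤_; 1/_; _⊔_; _/_; ∣_∣; Positive; ≢-nonZero)
import Data.Rational.Properties as ℚ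
open import Data.Rational.Solver using (module +-*-Solver)
open import Data.Rational.Unnormalised.Base as ℚᵘ using (mkℚᵘ)
import Data.Rational.Unnormalised.Properties as ℚᵘ
open import Data.Sum.Base using (_⊎_; inj₁; inj₂)
open import Data.Sum.Function.Propositional using (_⊎-↔_)
open import Data.Vec.Base using ([]; _∷_; here; there)
import Data.Vec.Functional as F
open import Function.Base using (_∘_; id)
open import Function.Bundles using (_↔_; _⇔_; Inverse; mk⇔; mk↔ₛ′)
open import Function.Construct.Composition using (_↔-∘_)
open import Function.Construct.Symmetry using (↔-sym)
open import Level using (0ℓ)
import Relation.Binary.Construct.Closure.Equivalence as Eq
open import Relation.Binary.Core using (Rel)
open import Relation.Binary.Definitions using (DecidableEquality)
open import Relation.Binary.PropositionalEquality
open import Relation.Nullary using (¬_; ¬?; Dec; yes; no; does)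
open import Relation.Nullary.Decidable using (does-⇔; dec-true; toWitness)
open import Relation.Unary using (Pred; Decidable)

-- Every intermediate graph has a distinguished edge `e` whose ends are the terminals. A facial walk
-- through a dart of `e` meets both ends, so the condition on the outer face comes for free and only
-- genus 0 has to be maintained. Division is postponed: a network records q Z_st + Z_s|t = y Z_s|t.
-- A parallel edge of weight w multiplies the left side by 1 + w and leaves Z_s|t alone; a
-- subdivision obeying the series law multiplies both sums by one nonzero factor. Hence a path can
-- be added as a single edge of its effective weight, whether or not that weight is allowed, and be
-- subdivided afterwards. The greedy choice must decide whether y stays at least the target, and the
-- order of the reals is not decidable. So T* is replaced by a rational slightly below it, within a
-- small fraction of π, and the greedy argument is rational throughout.

private variable
  A B C : Set
  R R′ : Rel A 0ℓ
  k k′ ℓ m n : ℕ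
  ε q x y z : ℚ
  αs : List ℚ

-- Numbers of equivalence classes

classes-≤ : Classes R k → Classes R k′ → k ℕ.≤ k′
classes-≤ C D = injective⇒≤ {f = λ c → D.class (rep c)} λ {c} {d} eq → begin
  c               ≡⟨ proj₂ (C.surjective c) ⟨
  C.class (rep c) ≡⟨ C.sound (D.complete eq) ⟩
  C.class (rep d) ≡⟨ proj₂ (C.surjective d) ⟩
  d               ∎
  where
  module C = Classes C
  module D = Classes D
  open ≡-Reasoning
  rep = proj₁ ∘ C.surjective

-- `κ` comes out of a recursion over the edges. By uniqueness any numbering of the components
-- computes it, so the counts below do not depend on that recursion.
classes-unique : Classes R k → Classes R k′ → k ≡ k′
classes-unique C D = ℕ.≤-antisym (classes-≤ C D) (classes-≤ D C)

classes-map : (f : A → B) → (∀ b → ∃ λ a → f a ≡ b) →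
              (∀ {x y} → R x y → R′ (f x) (f y)) →
              (∀ {x y} → R′ (f x) (f y) → R x y) →
              Classes R′ k → Classes R k
classes-map f onto to from C = record
  { class      = class ∘ f
  ; surjective = λ c → let b , b≡ = surjective c ; a , a≡ = onto b in a , trans (cong class a≡) b≡
  ; sound      = sound ∘ to
  ; complete   = from ∘ complete
  }
  where open Classes C

-- Orbits

module _ {f : A → A} where

  orbit-trans : ∀ {x y z} → SameOrbit f x y → SameOrbit f y z → SameOrbit f x z
  orbit-trans (zero  , refl) q = q
  orbit-trans (suc k , p)    q = let l , r = orbit-trans (k , p) q in suc l , r

  orbit-step : ∀ {x y} → f x ≡ y → SameOrbit f x y
  orbit-step eq = 1 , eq

-- `SameOrbit` iterates forwards only; `reachable`, which holds for both orders of a pair, takes the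
-- place of inverse iteration.
record Orbits (f : A → A) (c : A → C) : Set where
  field
    invariant : ∀ x → c (f x) ≡ c x
    reachable : ∀ {x y} → c x ≡ c y → SameOrbit f x y

  sameOrbit⇒≡ : ∀ {x y} → SameOrbit f x y → c x ≡ c y
  sameOrbit⇒≡ (zero  , refl) = refl
  sameOrbit⇒≡ (suc k , p)    = trans (sym (invariant _)) (sameOrbit⇒≡ (k , p))

module _ {f : A → A} {g : B → B} (ι : A → B) (step : ∀ x → SameOrbit g (ι x) (ι (f x))) where

  -- One step of `f` may cost several steps of `g`: after a graph operation, new darts intervene
  -- between consecutive old ones.
  orbit-map : ∀ {x y} → SameOrbit f x y → SameOrbit g (ι x) (ι y)
  orbit-map (zero  , refl) = 0 , refl
  orbit-map (suc k , p)    = orbit-trans (step _) (orbit-map (k , p))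

module Swap (_≟ᴬ_ : DecidableEquality A) where

  swap : A → A → A → A
  swap a b x with x ≟ᴬ a | x ≟ᴬ b
  ... | yes _ | _     = b
  ... | no  _ | yes _ = a
  ... | no  _ | no _  = x

  swap-left : ∀ a b → swap a b a ≡ b
  swap-left a b with a ≟ᴬ a
  ... | yes _ = refl
  ... | no ≢  = ⊥-elim (≢ refl)

  swap-right : ∀ a b → swap a b b ≡ a
  swap-right a b with b ≟ᴬ a | b ≟ᴬ b
  ... | yes b≡a | _    = b≡a
  ... | no  _   | yes _ = refl
  ... | no  _   | no ≢  = ⊥-elim (≢ refl)

  swap-other : ∀ {a b x} → x ≢ a → x ≢ b → swap a b x ≡ x
  swap-other {a} {b} {x} x≢a x≢b with x ≟ᴬ a | x ≟ᴬ b
  ... | yes x≡a | _       = ⊥-elim (x≢a x≡a)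
  ... | no  _   | yes x≡b = ⊥-elim (x≢b x≡b)
  ... | no  _   | no _    = refl

  swap-involutive : ∀ a b x → swap a b (swap a b x) ≡ x
  swap-involutive a b x with x ≟ᴬ a | x ≟ᴬ b
  ... | yes refl | _        = swap-right a b
  ... | no  _    | yes refl = swap-left a b
  ... | no x≢a   | no x≢b   = swap-other x≢a x≢b

  swap-invariant : (c : A → C) → ∀ {a b} → c a ≡ c b → ∀ x → c (swap a b x) ≡ c x
  swap-invariant c {a} {b} eq x with x ≟ᴬ a | x ≟ᴬ b
  ... | yes refl | _        = sym eq
  ... | no  _    | yes refl = eq
  ... | no  _    | no _     = refl

  swap-↔ : A → A → A ↔ A
  swap-↔ a b = mk↔ₛ′ (swap a b) (swap a b) (swap-involutive a b) (swap-involutive a b)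

-- Connected plane graphs

Ends : ℕ → ℕ → Set
Ends n m = Fin m → Fin n × Fin n

graph : Ends n m → Graph
graph {n} {m} ends = record { #V = n ; #E = m ; ends = ends }

-- For connected graphs without isolated vertices Euler's formula reads V + F = E + 2, and each
-- operation below adds one to both sides.
record Plane {n m : ℕ} (ends : Ends n m) : Set where
  G = graph ends
  field
    rotation : Dart G ↔ Dart G

  rotate : Dart G → Dart G
  rotate = Inverse.to rotation

  along : Dart G → Dart G
  along = rotate ∘ opposite G

  field
    vertices    : Orbits rotate (tail G)
    noIsolated  : ∀ v → ∃ λ d → tail G d ≡ v
    #F          : ℕ
    face        : Dart G → Fin #F
    face-onto   : ∀ c → ∃ λ d → face d ≡ c
    faces       : Orbits along face
    connected   : ∀ u v → Connected G ⊤ u v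
    euler       : n ℕ.+ #F ≡ m ℕ.+ 2

-- The dart `(e , false)` leaves `s`. Its successor on the facial walk is the rotation of
-- `(e , true)` and so leaves `t`. Thus the ends of any edge share a face, which can be made the
-- outer one.
plane⇒planarWithTerminals : {ends : Ends n m} → Plane ends → ∀ e →
                            let (s , t) = ends e in s ≢ t → PlanarWithTerminals (graph ends) s t
plane⇒planarWithTerminals {n} {m} {ends} P e s≢t = s≢t , embedding ,
  λ _ → (e , false) , along (e , false) , refl ,
        Orbits.invariant vertices (e , true) , orbit-step refl
  where
  open Plane P
  s = proj₁ (ends e)

  none : #isolated G ≡ 0
  none = cong length (filter-none (isolated? G) (All.universal not-isolated (allFin n)))
    where
    not-isolated : ∀ v → ¬ (∀ e → proj₁ (ends e) ≢ v × proj₂ (ends e) ≢ v)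
    not-isolated v iso with noIsolated v
    ... | (e , false) , eq = proj₁ (iso e) eq
    ... | (e , true)  , eq = proj₂ (iso e) eq

  one : κ G (allEdges G) ≡ 1
  one = classes-unique (proj₂ (components G (allEdges G))) record
    { class      = λ _ → zero
    ; surjective = λ { zero → s , refl }
    ; sound      = λ _ → refl
    ; complete   = λ _ → connected _ _
    }

  embedding : PlaneEmbedding G
  embedding = record
    { rotation   = rotation
    ; atVertices = λ d d′ → mk⇔ (Orbits.reachable vertices) (Orbits.sameOrbit⇒≡ vertices)
    ; #F         = #F
    ; faces      = record
      { class      = face
      ; surjective = face-onto
      ; sound      = Orbits.sameOrbit⇒≡ faces
      ; complete   = Orbits.reachable faces
      }
    ; euler      = begin
        n ℕ.+ (#F ℕ.+ #isolated G)     ≡⟨ cong (λ i → n ℕ.+ (#F ℕ.+ i)) none ⟩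
        n ℕ.+ (#F ℕ.+ 0)               ≡⟨ cong (n ℕ.+_) (ℕ.+-identityʳ #F) ⟩
        n ℕ.+ #F                       ≡⟨ euler ⟩
        m ℕ.+ 2                        ≡⟨ cong (λ k → m ℕ.+ 2 ℕ.* k) one ⟨
        m ℕ.+ 2 ℕ.* κ G (allEdges G)   ∎
    }
    where open ≡-Reasoning

edgeless : Ends n 0
edgeless ()

single : Ends 2 1
single = (zero , suc zero) F.∷ edgeless

single-plane : Plane single
single-plane = record
  { rotation   = mk↔ₛ′ id id (λ _ → refl) (λ _ → refl)
  ; vertices   = record
    { invariant = λ _ → refl
    ; reachable = λ { {zero , false} {zero , false} _ → 0 , refl
                    ; {zero , true}  {zero , true}  _ → 0 , refl }
    }
  ; noIsolated = λ { zero → (zero , false) , refl ; (suc zero) → (zero , true) , refl }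
  ; #F         = 1
  ; face       = λ _ → zero
  ; face-onto  = λ { zero → (zero , false) , refl }
  ; faces      = record
    { invariant = λ _ → refl
    ; reachable = λ { {zero , false} {zero , false} _ → 0 , refl
                    ; {zero , false} {zero , true}  _ → 1 , refl
                    ; {zero , true}  {zero , false} _ → 1 , refl
                    ; {zero , true}  {zero , true}  _ → 0 , refl }
    }
  ; connected  = λ { zero zero → Eq.reflexive _
                   ; zero (suc zero) → edge
                   ; (suc zero) zero → Eq.symmetric _ edge
                   ; (suc zero) (suc zero) → Eq.reflexive _ }
  ; euler      = refl
  }
  where
  edge : Connected (graph single) ⊤ zero (suc zero)
  edge = Eq.return (zero , here , refl)

-- Subdividing an edge

subdivide : Ends n (suc m) → Ends (suc n) (suc (suc m))
subdivide ends zero          = suc (proj₁ (ends zero)) , zero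
subdivide ends (suc zero)    = zero , suc (proj₂ (ends zero))
subdivide ends (suc (suc e)) = map suc suc (ends (suc e))

-- `w` is an end of the subdivided edge: one to which the chosen edges attach the new vertex `zero`,
-- or an arbitrary one if `zero` is isolated.
contract : Fin n → Fin (suc n) → Fin n
contract w zero    = w
contract w (suc x) = x

module Contraction {ends′ : Ends (suc n) k} {ends : Ends n m} {B : Subset k} {A : Subset m} (w : Fin n)
  (down : ∀ {x y} → Adjacent ends′ B x y → Connected (graph ends) A (contract w x) (contract w y))
  (up   : ∀ {x y} → Adjacent ends A x y → Connected (graph ends′) B (suc x) (suc y))
  where

  project : ∀ {x y} → Connected (graph ends′) B x y → Connected (graph ends) A (contract w x) (contract w y)
  project = Eq.gfold (Eq.isEquivalence _) (contract w) down

  lift : ∀ {x y} → Connected (graph ends) A x y → Connected (graph ends′) B (suc x) (suc y)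
  lift = Eq.gfold (Eq.isEquivalence _) suc up

  old-⇔ : ∀ x y → Connected (graph ends′) B (suc x) (suc y) ⇔ Connected (graph ends) A x y
  old-⇔ x y = mk⇔ project lift

  module Attached (link : Connected (graph ends′) B zero (suc w)) where

    expand : ∀ x → Connected (graph ends′) B x (suc (contract w x))
    expand zero    = link
    expand (suc x) = Eq.reflexive _

    κ-≡ : κ (graph ends′) B ≡ κ (graph ends) A
    κ-≡ = classes-unique (proj₂ (components (graph ends′) B))
      (classes-map (contract w) (λ x → suc x , refl) project
        (λ p → Eq.transitive _ (expand _) (Eq.transitive _ (lift p) (Eq.symmetric _ (expand _))))
        (proj₂ (components (graph ends) A)))

  module Isolated (isolated : ∀ {x y} → Adjacent ends′ B x y →
                              ∃ λ x′ → ∃ λ y′ → x ≡ suc x′ × y ≡ suc y′) where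

    κ-suc : κ (graph ends′) B ≡ suc (κ (graph ends) A)
    κ-suc = classes-unique (proj₂ (components (graph ends′) B)) record
      { class      = class′
      ; surjective = λ { zero → zero , refl
                       ; (suc c) → let x , eq = surjective c in suc x , cong suc eq }
      ; sound      = Eq.gfold isEquivalence class′ λ r → case-isolated r (isolated r)
      ; complete   = complete′ _ _
      }
      where
      open Classes (proj₂ (components (graph ends) A))
      class′ : Fin (suc n) → Fin (suc (κ (graph ends) A))
      class′ zero    = zero
      class′ (suc x) = suc (class x)
      case-isolated : ∀ {x y} → Adjacent ends′ B x y → (∃ λ x′ → ∃ λ y′ → x ≡ suc x′ × y ≡ suc y′) →
                      class′ x ≡ class′ y
      case-isolated r (_ , _ , refl , refl) = cong suc (sound (down r))
      complete′ : ∀ x y → class′ x ≡ class′ y → Connected (graph ends′) B x y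
      complete′ zero    zero    _  = Eq.reflexive _
      complete′ (suc x) (suc y) eq = lift (complete (suc-injective eq))

module _ (ends : Ends n (suc m)) (A : Subset m) where

  private
    G = graph ends
    G′ = graph (subdivide ends)
    u = proj₁ (ends zero)
    v = proj₂ (ends zero)

    keep : ∀ {b e x y} → ends (suc e) ≡ (x , y) → e Subset.∈ A →
           Connected G (b ∷ A) x y
    keep eq e∈A = Eq.return (suc _ , there e∈A , eq)

    keep′ : ∀ {b c e x y} → ends (suc e) ≡ (x , y) → e Subset.∈ A →
            Connected G′ (b ∷ c ∷ A) (suc x) (suc y)
    keep′ eq e∈A = Eq.return (suc (suc _) , there (there e∈A) , cong (map suc suc) eq)

    half₁ : ∀ {c} → Connected G′ (inside ∷ c ∷ A) (suc u) zero
    half₁ = Eq.return (zero , here , refl)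

    half₂ : ∀ {c} → Connected G′ (c ∷ inside ∷ A) zero (suc v)
    half₂ = Eq.return (suc zero , there here , refl)

    up : ∀ {b c x y} → Adjacent ends (outside ∷ A) x y → Connected G′ (b ∷ c ∷ A) (suc x) (suc y)
    up (suc e , there e∈A , eq) = keep′ eq e∈A

    up₁₂ : ∀ {x y} → Adjacent ends (inside ∷ A) x y → Connected G′ (inside ∷ inside ∷ A) (suc x) (suc y)
    up₁₂ (zero , _ , refl)         = Eq.transitive _ half₁ half₂
    up₁₂ (suc e , there e∈A , eq) = keep′ eq e∈A

    Down : Subset (suc (suc m)) → Subset (suc m) → Fin n → Set
    Down B A w = ∀ {x y} → Adjacent (subdivide ends) B x y → Connected G A (contract w x) (contract w y)

    down : Down (outside ∷ outside ∷ A) (outside ∷ A) u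
    down (suc zero    , there ()         , _)
    down (suc (suc e) , there (there e∈A) , refl) = keep refl e∈A

    down₁ : Down (inside ∷ outside ∷ A) (outside ∷ A) u
    down₁ (zero        , _                 , refl) = Eq.reflexive _
    down₁ (suc zero    , there ()          , _)
    down₁ (suc (suc e) , there (there e∈A) , refl) = keep refl e∈A

    down₂ : Down (outside ∷ inside ∷ A) (outside ∷ A) v
    down₂ (suc zero    , _                 , refl) = Eq.reflexive _
    down₂ (suc (suc e) , there (there e∈A) , refl) = keep refl e∈A

    down₁₂ : Down (inside ∷ inside ∷ A) (inside ∷ A) u
    down₁₂ (zero        , _                 , refl) = Eq.reflexive _
    down₁₂ (suc zero    , _                 , refl) = Eq.return (zero , here , refl)
    down₁₂ (suc (suc e) , there (there e∈A) , refl) = keep refl e∈A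

  module Neither = Contraction {ends′ = subdivide ends} {ends} {outside ∷ outside ∷ A} {outside ∷ A} u down up
  module First   = Contraction {ends′ = subdivide ends} {ends} {inside ∷ outside ∷ A} {outside ∷ A} u down₁ up
  module Second  = Contraction {ends′ = subdivide ends} {ends} {outside ∷ inside ∷ A} {outside ∷ A} v down₂ up
  module Both    = Contraction {ends′ = subdivide ends} {ends} {inside ∷ inside ∷ A} {inside ∷ A} u down₁₂ up₁₂

  κ-neither : κ G′ (outside ∷ outside ∷ A) ≡ suc (κ G (outside ∷ A))
  κ-neither = Neither.Isolated.κ-suc λ { (suc zero , there () , _) ; (suc (suc e) , _ , refl) → _ , _ , refl , refl }

  κ-first : κ G′ (inside ∷ outside ∷ A) ≡ κ G (outside ∷ A)
  κ-first = First.Attached.κ-≡ (Eq.symmetric _ half₁)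

  κ-second : κ G′ (outside ∷ inside ∷ A) ≡ κ G (outside ∷ A)
  κ-second = Second.Attached.κ-≡ half₂

  κ-both : κ G′ (inside ∷ inside ∷ A) ≡ κ G (inside ∷ A)
  κ-both = Both.Attached.κ-≡ (Eq.symmetric _ half₁)

module _ {m : ℕ} where

  -- Each half inherits the dart at its old end, so tails and rotations at the old vertices carry
  -- over; the two darts left over are those at the new vertex.
  oldDart : Fin (suc m) × Bool → Fin (suc (suc m)) × Bool
  oldDart (zero  , false) = zero , false
  oldDart (zero  , true)  = suc zero , true
  oldDart (suc e , b)     = suc (suc e) , b

  -- Following the old dart (zero , b) one meets the new dart midDart b.

  midDart : Bool → Fin (suc (suc m)) × Bool
  midDart false = suc zero , false
  midDart true  = zero , true

  dart : (Fin (suc m) × Bool) ⊎ Bool → Fin (suc (suc m)) × Bool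
  dart (inj₁ d) = oldDart d
  dart (inj₂ b) = midDart b

  undart : Fin (suc (suc m)) × Bool → (Fin (suc m) × Bool) ⊎ Bool
  undart (zero , false)    = inj₁ (zero , false)
  undart (zero , true)     = inj₂ true
  undart (suc zero , true) = inj₁ (zero , true)
  undart (suc zero , false) = inj₂ false
  undart (suc (suc e) , b) = inj₁ (suc e , b)

  undart-dart : ∀ d → undart (dart d) ≡ d
  undart-dart (inj₁ (zero , false)) = refl
  undart-dart (inj₁ (zero , true))  = refl
  undart-dart (inj₁ (suc e , b))    = refl
  undart-dart (inj₂ false)          = refl
  undart-dart (inj₂ true)           = refl

  dart-undart : ∀ d → dart (undart d) ≡ d
  dart-undart (zero , false)     = refl
  dart-undart (zero , true)      = refl
  dart-undart (suc zero , true)  = refl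
  dart-undart (suc zero , false) = refl
  dart-undart (suc (suc e) , b)  = refl

  dart-↔ : ((Fin (suc m) × Bool) ⊎ Bool) ↔ (Fin (suc (suc m)) × Bool)
  dart-↔ = mk↔ₛ′ dart undart dart-undart undart-dart

  data DartView : Fin (suc (suc m)) × Bool → Set where
    old : ∀ d → DartView (oldDart d)
    mid : ∀ b → DartView (midDart b)

  dartView : ∀ d → DartView d
  dartView (zero , false)     = old (zero , false)
  dartView (zero , true)      = mid true
  dartView (suc zero , true)  = old (zero , true)
  dartView (suc zero , false) = mid false
  dartView (suc (suc e) , b)  = old (suc e , b)

not-↔ : Bool ↔ Bool
not-↔ = mk↔ₛ′ not not not² not²
  where
  not² : ∀ b → not (not b) ≡ b
  not² false = refl
  not² true  = refl

-- Each of the two passages along the subdivided edge gains one intermediate dart, and no facial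
-- walk splits or merges. So V and E grow by one while F stays.
subdivide-plane : {ends : Ends n (suc m)} → Plane ends → Plane (subdivide ends)
subdivide-plane {n} {m} {ends} P = record
  { rotation   = rotation′
  ; vertices   = record
    { invariant = λ d → vertex-invariant (dartView d)
    ; reachable = λ {d} {d′} → vertex-reachable (dartView d) (dartView d′)
    }
  ; noIsolated = λ { zero → midDart true , refl
                   ; (suc v) → let d , eq = noIsolated v in oldDart d , trans (tail-old d) (cong suc eq) }
  ; #F         = #F
  ; face       = face′
  ; face-onto  = λ c → let d , eq = face-onto c in oldDart d , trans (face-old d) eq
  ; faces      = record
    { invariant = λ d → face-invariant (dartView d)
    ; reachable = λ {d} {d′} → face-reachable (dartView d) (dartView d′)
    }
  ; connected  = λ x y → Eq.transitive _ (Link.expand x)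
                   (Eq.transitive _ (Both.lift ends ⊤ (connected _ _)) (Eq.symmetric _ (Link.expand y)))
  ; euler      = cong suc euler
  }
  where
  open Plane P
  G′ = graph (subdivide ends)
  module Link = Both.Attached ends ⊤ (Eq.symmetric _ (Eq.return (zero , here , refl)))

  -- `not-↔` makes the two darts at the new vertex a cycle of length two.
  rotation′ : Dart G′ ↔ Dart G′
  rotation′ = dart-↔ ↔-∘ ((rotation ⊎-↔ not-↔) ↔-∘ ↔-sym dart-↔)

  rotate′ : Dart G′ → Dart G′
  rotate′ = Inverse.to rotation′

  rotate-old : ∀ d → rotate′ (oldDart d) ≡ oldDart (rotate d)
  rotate-old d rewrite undart-dart (inj₁ d) = refl

  tail-old : ∀ d → tail G′ (oldDart d) ≡ suc (tail G d)
  tail-old (zero  , false) = refl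
  tail-old (zero  , true)  = refl
  tail-old (suc e , false) = refl
  tail-old (suc e , true)  = refl

  vertex-invariant : ∀ {d} → DartView d → tail G′ (rotate′ d) ≡ tail G′ d
  vertex-invariant (old d)     = begin
    tail G′ (rotate′ (oldDart d)) ≡⟨ cong (tail G′) (rotate-old d) ⟩
    tail G′ (oldDart (rotate d))  ≡⟨ tail-old (rotate d) ⟩
    suc (tail G (rotate d))       ≡⟨ cong suc (Orbits.invariant vertices d) ⟩
    suc (tail G d)                ≡⟨ tail-old d ⟨
    tail G′ (oldDart d)           ∎
    where open ≡-Reasoning
  vertex-invariant (mid false) = refl
  vertex-invariant (mid true)  = refl

  tail-mid : ∀ b → tail G′ (midDart b) ≡ zero
  tail-mid false = refl
  tail-mid true  = refl

  vertex-reachable : ∀ {d d′} → DartView d → DartView d′ → tail G′ d ≡ tail G′ d′ → SameOrbit rotate′ d d′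
  vertex-reachable (old d) (old d′) eq = orbit-map oldDart (λ d → orbit-step (rotate-old d))
    (Orbits.reachable vertices (suc-injective (trans (sym (tail-old d)) (trans eq (tail-old d′)))))
  vertex-reachable (old d) (mid b)  eq with () ← trans (sym (tail-old d)) (trans eq (tail-mid b))
  vertex-reachable (mid b) (old d)  eq with () ← trans (sym (tail-mid b)) (trans eq (tail-old d))
  vertex-reachable (mid false) (mid false) _ = 0 , refl
  vertex-reachable (mid false) (mid true)  _ = 1 , refl
  vertex-reachable (mid true)  (mid false) _ = 1 , refl
  vertex-reachable (mid true)  (mid true)  _ = 0 , refl

  along′ : Dart G′ → Dart G′
  along′ = rotate′ ∘ opposite G′

  along-zero : ∀ b → along′ (oldDart (zero , b)) ≡ midDart b
  along-zero false = refl
  along-zero true  = refl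

  along-mid : ∀ b → along′ (midDart b) ≡ oldDart (along (zero , b))
  along-mid false = refl
  along-mid true  = refl

  along-suc : ∀ e b → along′ (oldDart (suc e , b)) ≡ oldDart (along (suc e , b))
  along-suc e b = refl

  face₀ : (Fin (suc m) × Bool) ⊎ Bool → Fin #F
  face₀ (inj₁ d) = face d
  face₀ (inj₂ b) = face (zero , b)

  face′ : Dart G′ → Fin #F
  face′ = face₀ ∘ undart

  face-old : ∀ d → face′ (oldDart d) ≡ face d
  face-old d = cong face₀ (undart-dart (inj₁ d))

  face-mid : ∀ b → face′ (midDart b) ≡ face (zero , b)
  face-mid b = cong face₀ (undart-dart (inj₂ b))

  face-invariant : ∀ {d} → DartView d → face′ (along′ d) ≡ face′ d
  face-invariant (old (zero , b)) =
    trans (cong face′ (along-zero b)) (trans (face-mid b) (sym (face-old (zero , b))))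
  face-invariant (old (suc e , b)) = trans (face-old (along (suc e , b))) (Orbits.invariant faces (suc e , b))
  face-invariant (mid b) = trans (cong face′ (along-mid b))
    (trans (face-old (along (zero , b))) (trans (Orbits.invariant faces (zero , b)) (sym (face-mid b))))

  mid→old : ∀ b → SameOrbit along′ (midDart b) (oldDart (along (zero , b)))
  mid→old b = orbit-step (along-mid b)

  step : ∀ d → SameOrbit along′ (oldDart d) (oldDart (along d))
  step (zero  , b) = orbit-trans (orbit-step (along-zero b)) (mid→old b)
  step (suc e , b) = orbit-step (along-suc e b)

  -- As orbits run forwards only, a dart needs an old dart after it, to start the comparison with
  -- the old face, and (in `from`) an old dart before it, to end it.
  into : ∀ {d} → DartView d → ∃ λ x → SameOrbit along′ d (oldDart x) × face x ≡ face′ d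
  into (old d) = d , (0 , refl) , sym (face-old d)
  into (mid b) = along (zero , b) , mid→old b , trans (Orbits.invariant faces (zero , b)) (sym (face-mid b))

  from : ∀ {d} → DartView d → ∃ λ x → SameOrbit along′ (oldDart x) d × face x ≡ face′ d
  from (old d) = d , (0 , refl) , sym (face-old d)
  from (mid b) = (zero , b) , orbit-step (along-zero b) , sym (face-mid b)

  face-reachable : ∀ {d d′} → DartView d → DartView d′ → face′ d ≡ face′ d′ → SameOrbit along′ d d′
  face-reachable v v′ eq =
    let x , d→x , x≡ = into v ; y , y→d′ , y≡ = from v′
    in orbit-trans d→x (orbit-trans
         (orbit-map oldDart step (Orbits.reachable faces (trans x≡ (trans eq (sym y≡))))) y→d′)

-- Doubling an edge

module _ {m : ℕ} where

  shiftDart : Fin m × Bool → Fin (suc m) × Bool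
  shiftDart = map suc id

  shiftDart-injective : ∀ {d d′} → shiftDart d ≡ shiftDart d′ → d ≡ d′
  shiftDart-injective refl = refl

  extend : (Fin m × Bool → Fin m × Bool) → Fin (suc m) × Bool → Fin (suc m) × Bool
  extend f (zero  , b) = zero , b
  extend f (suc e , b) = shiftDart (f (e , b))

  extend-↔ : (Fin m × Bool) ↔ (Fin m × Bool) → (Fin (suc m) × Bool) ↔ (Fin (suc m) × Bool)
  extend-↔ ρ = mk↔ₛ′ (extend to) (extend from)
    (λ { (zero , b) → refl ; (suc e , b) → cong shiftDart (strictlyInverseˡ (e , b)) })
    (λ { (zero , b) → refl ; (suc e , b) → cong shiftDart (strictlyInverseʳ (e , b)) })
    where open Inverse ρ

parallel : Ends n m → Fin m → Ends n (suc m)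
parallel ends e = ends e F.∷ ends

-- The new edge is drawn along edge e, so that the two bound a digon, whose
-- boundary consists of the darts (suc e , false) and (zero , true).  On the
-- boundary of the face that contained (suc e , false) its place is taken by
-- (zero , false).

parallel-plane : {ends : Ends n m} → Plane ends → ∀ e → Plane (parallel ends e)
parallel-plane {n} {m} {ends} P e = record
  { rotation   = rotation′
  ; vertices   = record
    { invariant = vertex-invariant
    ; reachable = vertex-reachable _ _
    }
  ; noIsolated = λ v → let d , eq = noIsolated v in shiftDart d , trans (tail-shift d) eq
  ; #F         = suc #F
  ; face       = face′
  ; face-onto  = λ { zero → r , refl
                   ; (suc c) → let d , eq = face-onto c in relabel d , trans (face-relabel d) (cong suc eq) }
  ; faces      = record
    { invariant = λ d → face-invariant (view d)
    ; reachable = λ {d} {d′} → face-reachable (view d) (view d′)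
    }
  ; connected  = λ x y → Eq.map (λ { (e , _ , eq) → suc e , ∈⊤ , eq }) (connected x y)
  ; euler      = trans (ℕ.+-suc n #F) (cong suc euler)
  }
  where
  open Plane P
  G′ = graph (parallel ends e)

  _≟ᴰ_ : DecidableEquality (Dart G′)
  _≟ᴰ_ = ≡-dec _≟_ Bool._≟_
  open Swap _≟ᴰ_

  a b p r : Dart G′
  a = suc e , false
  b = suc e , true
  p = zero , false
  r = zero , true

  -- The effect of the two transpositions is to insert `p` just before `a` in the cyclic order at
  -- one end, and `r` just after `b` at the other.
  rotation′ : Dart G′ ↔ Dart G′
  rotation′ = swap-↔ a p ↔-∘ (extend-↔ rotation ↔-∘ swap-↔ b r)

  rotate′ along′ : Dart G′ → Dart G′
  rotate′ = Inverse.to rotation′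
  along′ = rotate′ ∘ opposite G′

  tail-shift : ∀ d → tail G′ (shiftDart d) ≡ tail G d
  tail-shift (_ , false) = refl
  tail-shift (_ , true)  = refl

  extend-invariant : ∀ d → tail G′ (extend rotate d) ≡ tail G′ d
  extend-invariant (zero  , _) = refl
  extend-invariant (suc e , b) =
    trans (tail-shift (rotate (e , b))) (trans (Orbits.invariant vertices (e , b)) (sym (tail-shift (e , b))))

  vertex-invariant : ∀ d → tail G′ (rotate′ d) ≡ tail G′ d
  vertex-invariant d = trans (swap-invariant (tail G′) {a} {p} refl (extend rotate (swap b r d)))
    (trans (extend-invariant (swap b r d)) (swap-invariant (tail G′) {b} {r} refl d))

  -- Old darts are embedded in two ways: `shiftDart` keeps the edge and serves for the orbits at
  -- vertices, `relabel` commutes with `along` and serves for the faces.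
  relabel : Dart G → Dart G′
  relabel = swap a p ∘ shiftDart

  rotate-b : rotate′ b ≡ r
  rotate-b rewrite swap-left b r = swap-other {a} {p} (λ ()) (λ ())

  rotate-r : rotate′ r ≡ relabel (rotate (e , true))
  rotate-r rewrite swap-right b r = refl

  rotate-p : rotate′ p ≡ a
  rotate-p rewrite swap-other {b} {r} {p} (λ ()) (λ ()) = swap-right a p

  rotate-shift : ∀ d → d ≢ (e , true) → rotate′ (shiftDart d) ≡ relabel (rotate d)
  rotate-shift d d≢ rewrite swap-other {b} {r} {shiftDart d} (d≢ ∘ shiftDart-injective) (λ ()) = refl

  shift→relabel : ∀ d → SameOrbit rotate′ (shiftDart d) (relabel (rotate d))
  shift→relabel d with d ≟ᴰ′ (e , true)
    where
    _≟ᴰ′_ : DecidableEquality (Dart G)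
    _≟ᴰ′_ = ≡-dec _≟_ Bool._≟_
  ... | yes refl = orbit-trans (orbit-step rotate-b) (orbit-step rotate-r)
  ... | no d≢    = orbit-step (rotate-shift d d≢)

  relabel→shift : ∀ d → SameOrbit rotate′ (relabel d) (shiftDart d)
  relabel→shift d with shiftDart d ≟ᴰ a
  ... | yes eq  = orbit-step (trans rotate-p (sym eq))
  ... | no  d≢a with shiftDart d ≟ᴰ p
  ...   | no _  = 0 , refl

  step : ∀ d → SameOrbit rotate′ (shiftDart d) (shiftDart (rotate d))
  step d = orbit-trans (shift→relabel d) (relabel→shift (rotate d))

  into : ∀ z → ∃ λ d → SameOrbit rotate′ z (shiftDart d) × tail G d ≡ tail G′ z
  into (zero , false) = (e , false) , orbit-step rotate-p , refl
  into (zero , true)  = rotate (e , true) , orbit-trans (orbit-step rotate-r) (relabel→shift _) ,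
                        Orbits.invariant vertices (e , true)
  into (suc e , b)    = (e , b) , (0 , refl) , sym (tail-shift (e , b))

  from : ∀ z → ∃ λ d → SameOrbit rotate′ (shiftDart d) z × tail G d ≡ tail G′ z
  from (zero , false) = Inverse.from rotation (e , false) ,
    subst (SameOrbit rotate′ _) (trans (cong relabel back) (swap-left a p)) (shift→relabel _) ,
    trans (sym (Orbits.invariant vertices _)) (cong (tail G) back)
    where back = Inverse.strictlyInverseˡ rotation (e , false)
  from (zero , true)  = (e , true) , orbit-step rotate-b , refl
  from (suc e , b)    = (e , b) , (0 , refl) , sym (tail-shift (e , b))

  vertex-reachable : ∀ d d′ → tail G′ d ≡ tail G′ d′ → SameOrbit rotate′ d d′
  vertex-reachable d d′ eq =
    let x , d→x , x≡ = into d ; y , y→d′ , y≡ = from d′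
    in orbit-trans d→x (orbit-trans
         (orbit-map shiftDart step (Orbits.reachable vertices (trans x≡ (trans eq (sym y≡))))) y→d′)

  opposite-injective : ∀ d → opposite G d ≡ (e , true) → d ≡ (e , false)
  opposite-injective (_ , false) refl = refl

  along-relabel : ∀ d → along′ (relabel d) ≡ relabel (along d)
  along-relabel d with shiftDart d ≟ᴰ a
  ... | yes refl = rotate-r
  ... | no d≢a with shiftDart d ≟ᴰ p
  ...   | no _   = rotate-shift (opposite G d) (λ eq → d≢a (cong shiftDart (opposite-injective d eq)))

  face₀ : Dart G′ → Fin (suc #F)
  face₀ (zero  , _) = zero
  face₀ (suc e , b) = suc (face (e , b))

  face′ : Dart G′ → Fin (suc #F)
  face′ = face₀ ∘ swap a p

  face-relabel : ∀ d → face′ (relabel d) ≡ suc (face d)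
  face-relabel d = cong face₀ (swap-involutive a p (shiftDart d))

  data View : Dart G′ → Set where
    kept   : ∀ d → View (relabel d)
    digonˡ : View a
    digonʳ : View r

  view : ∀ d → View d
  view d with swap a p d in eq
  ... | z = subst View (trans (sym (cong (swap a p) eq)) (swap-involutive a p d)) (view-swap z)
    where
    view-swap : ∀ z → View (swap a p z)
    view-swap (zero , false) = subst View (sym (swap-right a p)) digonˡ
    view-swap (zero , true)  = subst View (sym (swap-other {a} {p} (λ ()) (λ ()))) digonʳ
    view-swap (suc e , b)    = kept (e , b)

  along-a : along′ a ≡ r
  along-a = rotate-b

  along-r : along′ r ≡ a
  along-r = rotate-p

  face-a : face′ a ≡ zero
  face-a = cong face₀ (swap-left a p)

  face-invariant : ∀ {d} → View d → face′ (along′ d) ≡ face′ d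
  face-invariant (kept d) = trans (cong face′ (along-relabel d))
    (trans (face-relabel (along d)) (trans (cong suc (Orbits.invariant faces d)) (sym (face-relabel d))))
  face-invariant digonˡ   = trans (cong face′ along-a) (sym face-a)
  face-invariant digonʳ   = trans (cong face′ along-r) face-a

  face-reachable : ∀ {d d′} → View d → View d′ → face′ d ≡ face′ d′ → SameOrbit along′ d d′
  face-reachable (kept d) (kept d′) eq = orbit-map relabel (λ d → orbit-step (along-relabel d))
    (Orbits.reachable faces (suc-injective (trans (sym (face-relabel d)) (trans eq (face-relabel d′)))))
  face-reachable (kept d) digonˡ eq with () ← trans (sym (face-relabel d)) (trans eq face-a)
  face-reachable (kept d) digonʳ eq with () ← trans (sym (face-relabel d)) eq
  face-reachable digonˡ (kept d) eq with () ← trans (sym face-a) (trans eq (face-relabel d))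
  face-reachable digonʳ (kept d) eq with () ← trans eq (face-relabel d)
  face-reachable digonˡ digonˡ _ = 0 , refl
  face-reachable digonˡ digonʳ _ = orbit-step along-a
  face-reachable digonʳ digonˡ _ = orbit-step along-r
  face-reachable digonʳ digonʳ _ = 0 , refl

-- Partition functions

∑ : (Subset m → ℚ) → ℚ
∑ {zero}  f = f []
∑ {suc m} f = ∑ (f ∘ (outside ∷_)) + ∑ (f ∘ (inside ∷_))

∑-cong : {f g : Subset m → ℚ} → (∀ A → f A ≡ g A) → ∑ f ≡ ∑ g
∑-cong {zero}  eq = eq []
∑-cong {suc m} eq = cong₂ _+_ (∑-cong (eq ∘ (outside ∷_))) (∑-cong (eq ∘ (inside ∷_)))

∑-* : ∀ c (f : Subset m → ℚ) → ∑ (λ A → c * f A) ≡ c * ∑ f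
∑-* {zero}  c f = refl
∑-* {suc m} c f = trans (cong₂ _+_ (∑-* c (f ∘ (outside ∷_))) (∑-* c (f ∘ (inside ∷_)))) (sym (ℚ.*-distribˡ-+ c _ _))

∑-+ : ∀ (f g : Subset m → ℚ) → ∑ (λ A → f A + g A) ≡ ∑ f + ∑ g
∑-+ {zero}  f g = refl
∑-+ {suc m} f g = trans (cong₂ _+_ (∑-+ (f ∘ (outside ∷_)) (g ∘ (outside ∷_))) (∑-+ (f ∘ (inside ∷_)) (g ∘ (inside ∷_))))
  (solve 4 (λ a b c d → (a :+ b) :+ (c :+ d) := (a :+ c) :+ (b :+ d)) refl
     (∑ (f ∘ (outside ∷_))) (∑ (g ∘ (outside ∷_))) (∑ (f ∘ (inside ∷_))) (∑ (g ∘ (inside ∷_))))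
  where open +-*-Solver

mask : Bool → ℚ → ℚ
mask b x = if b then x else 0ℚ

mask-* : ∀ b c x → mask b (c * x) ≡ c * mask b x
mask-* false c x = sym (ℚ.*-zeroʳ c)
mask-* true  c x = refl

sum-++ : ∀ xs ys → sum (xs ++ ys) ≡ sum xs + sum ys
sum-++ []       ys = sym (ℚ.+-identityˡ (sum ys))
sum-++ (x ∷ xs) ys = trans (cong (_+_ x) (sum-++ xs ys)) (sym (ℚ.+-assoc x (sum xs) (sum ys)))

sum-subsets : (f : Subset m → ℚ) → sum (List.map f (subsets m)) ≡ ∑ f
sum-subsets {zero}  f = ℚ.+-identityʳ (f [])
sum-subsets {suc m} f = begin
  sum (List.map f (List.map (outside ∷_) S ++ List.map (inside ∷_) S))
    ≡⟨ cong sum (map-++ f (List.map (outside ∷_) S) _) ⟩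
  sum (List.map f (List.map (outside ∷_) S) ++ List.map f (List.map (inside ∷_) S))
    ≡⟨ sum-++ (List.map f (List.map (outside ∷_) S)) _ ⟩
  sum (List.map f (List.map (outside ∷_) S)) + sum (List.map f (List.map (inside ∷_) S))
    ≡⟨ cong₂ (λ xs ys → sum xs + sum ys) (map-∘ S) (map-∘ S) ⟨
  sum (List.map (f ∘ (outside ∷_)) S) + sum (List.map (f ∘ (inside ∷_)) S)
    ≡⟨ cong₂ _+_ (sum-subsets (f ∘ (outside ∷_))) (sum-subsets (f ∘ (inside ∷_))) ⟩
  ∑ f ∎
  where
  open ≡-Reasoning
  S = subsets m

sum-filter : ∀ {P : Pred A 0ℓ} (P? : Decidable P) (f : A → ℚ) xs →
             sum (List.map f (filter P? xs)) ≡ sum (List.map (λ x → mask (does (P? x)) (f x)) xs)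
sum-filter P? f [] = refl
sum-filter P? f (x ∷ xs) with does (P? x)
... | false = trans (sum-filter P? f xs) (sym (ℚ.+-identityˡ _))
... | true  = cong (_+_ (f x)) (sum-filter P? f xs)

product-filter : ∀ {P : Pred A 0ℓ} (P? : Decidable P) (f : A → ℚ) xs →
  product (List.map f (filter P? xs)) ≡ product (List.map (λ x → if does (P? x) then f x else 1ℚ) xs)
product-filter P? f [] = refl
product-filter P? f (x ∷ xs) with does (P? x)
... | false = trans (product-filter P? f xs) (sym (ℚ.*-identityˡ _))
... | true  = cong (f x *_) (product-filter P? f xs)

weight : (Fin m → ℚ) → Subset m → ℚ
weight {m} w A = product (List.map w (filter (_∈? A) (allFin m)))

weight-∷ : ∀ (w : Fin (suc m) → ℚ) b A →
           weight w (b ∷ A) ≡ (if b then w zero else 1ℚ) * weight (w ∘ suc) A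
weight-∷ {m} w b A = begin
  weight w (b ∷ A)
    ≡⟨ product-filter (_∈? (b ∷ A)) w (allFin (suc m)) ⟩
  g zero * product (List.map g (List.tabulate suc))
    ≡⟨ cong₂ _*_ (head b) (cong product (trans (map-tabulate suc g) (sym (map-tabulate id (g ∘ suc))))) ⟩
  (if b then w zero else 1ℚ) * product (List.map (g ∘ suc) (allFin m))
    ≡⟨ cong ((if b then w zero else 1ℚ) *_) (product-filter (_∈? A) (w ∘ suc) (allFin m)) ⟨
  (if b then w zero else 1ℚ) * weight (w ∘ suc) A ∎
  where
  open ≡-Reasoning
  g : Fin (suc m) → ℚ
  g e = if does (e ∈? (b ∷ A)) then w e else 1ℚ
  head : ∀ b → (if does (zero ∈? (b ∷ A)) then w zero else 1ℚ) ≡ (if b then w zero else 1ℚ)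
  head false = refl
  head true  = refl

weight-outside : ∀ (w : Fin (suc m) → ℚ) A → weight w (outside ∷ A) ≡ weight (w ∘ suc) A
weight-outside w A = trans (weight-∷ w outside A) (ℚ.*-identityˡ _)

weight-inside : ∀ (w : Fin (suc m) → ℚ) A → weight w (inside ∷ A) ≡ w zero * weight (w ∘ suc) A
weight-inside w A = weight-∷ w inside A

module _ (q : ℚ) (ends : Ends n m) (w : Fin m → ℚ) (s t : Fin n) where

  joined? : Subset m → Bool
  joined? A = does (connected? (graph ends) A s t)

  Z-joined-∑ : Z-joined q (graph ends) w s t ≡ ∑ (λ A → mask (joined? A) (term q (graph ends) w A))
  Z-joined-∑ = trans (sum-filter (λ A → connected? (graph ends) A s t) (term q (graph ends) w) (subsets m))
                     (sum-subsets (λ A → mask (joined? A) (term q (graph ends) w A)))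

  Z-separated-∑ : Z-separated q (graph ends) w s t ≡
                  ∑ (λ A → mask (not (joined? A)) (term q (graph ends) w A))
  Z-separated-∑ = trans (sum-filter (λ A → ¬? (connected? (graph ends) A s t)) (term q (graph ends) w) (subsets m))
                        (sum-subsets (λ A → mask (not (joined? A)) (term q (graph ends) w A)))

-- Series composition

module _ (q : ℚ) (ends : Ends n (suc m)) (w : Fin (suc m) → ℚ) (α β : ℚ)
         (series : (q + α + β) * w zero ≡ α * β) where

  private
    G = graph ends
    G′ = graph (subdivide ends)

  series-weight : Fin (suc (suc m)) → ℚ
  series-weight = α F.∷ β F.∷ (w ∘ suc)

  private
    w′ = series-weight
    T  = term q G w
    T′ = term q G′ w′

    T₁ : Subset m → ℚ
    T₁ A = weight (w ∘ suc) A * q ^ κ G (inside ∷ A)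

    T₀ : Subset m → ℚ
    T₀ A = T (outside ∷ A)

    T₀-≡ : ∀ A → T₀ A ≡ weight (w ∘ suc) A * q ^ κ G (outside ∷ A)
    T₀-≡ A = cong (_* q ^ κ G (outside ∷ A)) (weight-outside w A)

    T₁-≡ : ∀ A → T (inside ∷ A) ≡ w zero * T₁ A
    T₁-≡ A = trans (cong (_* q ^ κ G (inside ∷ A)) (weight-inside w A)) (ℚ.*-assoc (w zero) _ _)

    oo : ∀ A → T′ (outside ∷ outside ∷ A) ≡ q * T₀ A
    oo A = begin
      weight w′ (outside ∷ outside ∷ A) * q ^ κ G′ (outside ∷ outside ∷ A)
        ≡⟨ cong₂ _*_ (trans (weight-outside w′ (outside ∷ A)) (weight-outside (w′ ∘ suc) A))
                     (cong (q ^_) (κ-neither ends A)) ⟩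
      weight (w ∘ suc) A * (q * q ^ κ G (outside ∷ A))
        ≡⟨ solve 3 (λ x q y → x :* (q :* y) := q :* (x :* y)) refl (weight (w ∘ suc) A) q (q ^ κ G (outside ∷ A)) ⟩
      q * (weight (w ∘ suc) A * q ^ κ G (outside ∷ A))
        ≡⟨ cong (q *_) (T₀-≡ A) ⟨
      q * T₀ A ∎
      where
      open ≡-Reasoning
      open +-*-Solver

    io : ∀ A → T′ (inside ∷ outside ∷ A) ≡ α * T₀ A
    io A = begin
      weight w′ (inside ∷ outside ∷ A) * q ^ κ G′ (inside ∷ outside ∷ A)
        ≡⟨ cong₂ _*_ (trans (weight-inside w′ (outside ∷ A)) (cong (α *_) (weight-outside (w′ ∘ suc) A)))
                     (cong (q ^_) (κ-first ends A)) ⟩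
      α * weight (w ∘ suc) A * q ^ κ G (outside ∷ A)
        ≡⟨ ℚ.*-assoc α _ _ ⟩
      α * (weight (w ∘ suc) A * q ^ κ G (outside ∷ A))
        ≡⟨ cong (α *_) (T₀-≡ A) ⟨
      α * T₀ A ∎
      where open ≡-Reasoning

    oi : ∀ A → T′ (outside ∷ inside ∷ A) ≡ β * T₀ A
    oi A = begin
      weight w′ (outside ∷ inside ∷ A) * q ^ κ G′ (outside ∷ inside ∷ A)
        ≡⟨ cong₂ _*_ (trans (weight-outside w′ (inside ∷ A)) (weight-inside (w′ ∘ suc) A))
                     (cong (q ^_) (κ-second ends A)) ⟩
      β * weight (w ∘ suc) A * q ^ κ G (outside ∷ A)
        ≡⟨ ℚ.*-assoc β _ _ ⟩
      β * (weight (w ∘ suc) A * q ^ κ G (outside ∷ A))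
        ≡⟨ cong (β *_) (T₀-≡ A) ⟨
      β * T₀ A ∎
      where open ≡-Reasoning

    ii : ∀ A → T′ (inside ∷ inside ∷ A) ≡ α * β * T₁ A
    ii A = begin
      weight w′ (inside ∷ inside ∷ A) * q ^ κ G′ (inside ∷ inside ∷ A)
        ≡⟨ cong₂ _*_ (trans (weight-inside w′ (inside ∷ A)) (cong (α *_) (weight-inside (w′ ∘ suc) A)))
                     (cong (q ^_) (κ-both ends A)) ⟩
      α * (β * weight (w ∘ suc) A) * q ^ κ G (inside ∷ A)
        ≡⟨ solve 4 (λ a b x y → a :* (b :* x) :* y := a :* b :* (x :* y)) refl α β (weight (w ∘ suc) A) (q ^ κ G (inside ∷ A)) ⟩
      α * β * T₁ A ∎
      where
      open ≡-Reasoning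
      open +-*-Solver

    ∑-mask : ∀ c {χ χ′ : Subset m → Bool} {f g : Subset m → ℚ} → (∀ A → χ′ A ≡ χ A) → (∀ A → f A ≡ c * g A) →
             ∑ (λ A → mask (χ′ A) (f A)) ≡ c * ∑ (λ A → mask (χ A) (g A))
    ∑-mask c {χ} {χ′} {f} {g} χ≡ f≡ = trans
      (∑-cong λ A → trans (cong₂ mask (χ≡ A) (f≡ A)) (mask-* (χ A) c (g A)))
      (∑-* c (λ A → mask (χ A) (g A)))

  module _ (χ : Subset (suc m) → Bool) (χ′ : Subset (suc (suc m)) → Bool)
    (χ-oo : ∀ A → χ′ (outside ∷ outside ∷ A) ≡ χ (outside ∷ A))
    (χ-oi : ∀ A → χ′ (outside ∷ inside ∷ A) ≡ χ (outside ∷ A))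
    (χ-io : ∀ A → χ′ (inside ∷ outside ∷ A) ≡ χ (outside ∷ A))
    (χ-ii : ∀ A → χ′ (inside ∷ inside ∷ A) ≡ χ (inside ∷ A))
    where

    -- Let `X` collect the sets without the old edge and `Y` those with it, its weight left out. The
    -- four states of the two halves give q X, β X, α X and α β Y; the first has the factor q
    -- because the middle vertex is then a component of its own. By `series` the total is q + α + β
    -- times X + w₀ Y. Leaving `χ` open covers both partition functions at once.
    ∑-series : ∑ (λ A → mask (χ′ A) (T′ A)) ≡ (q + α + β) * ∑ (λ A → mask (χ A) (T A))
    ∑-series = begin
      ∑ (λ A → mask (χ′ A) (T′ A))
        ≡⟨ cong₂ _+_ (cong₂ _+_ (∑-mask q χ-oo oo) (∑-mask β χ-oi oi))
                     (cong₂ _+_ (∑-mask α χ-io io) (∑-mask (α * β) χ-ii ii)) ⟩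
      (q * X + β * X) + (α * X + α * β * Y)
        ≡⟨ solve 5 (λ q α β X Z → (q :* X :+ β :* X) :+ (α :* X :+ Z) := (q :+ α :+ β) :* X :+ Z) refl q α β X (α * β * Y) ⟩
      (q + α + β) * X + α * β * Y
        ≡⟨ cong (λ c → (q + α + β) * X + c * Y) series ⟨
      (q + α + β) * X + (q + α + β) * w zero * Y
        ≡⟨ solve 4 (λ c X w Y → c :* X :+ c :* w :* Y := c :* (X :+ w :* Y)) refl (q + α + β) X (w zero) Y ⟩
      (q + α + β) * (X + w zero * Y)
        ≡⟨ cong (λ z → (q + α + β) * (X + z)) (∑-mask (w zero) (λ A → refl) T₁-≡) ⟨
      (q + α + β) * ∑ (λ A → mask (χ A) (T A)) ∎
      where
      open ≡-Reasoning
      open +-*-Solver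
      X = ∑ (λ A → mask (χ (outside ∷ A)) (T₀ A))
      Y = ∑ (λ A → mask (χ (inside ∷ A)) (T₁ A))

  module _ (s t : Fin n) where

    private
      χ  = joined? q ends w s t
      χ′ = joined? q (subdivide ends) w′ (suc s) (suc t)

      χ-oo : ∀ A → χ′ (outside ∷ outside ∷ A) ≡ χ (outside ∷ A)
      χ-oo A = does-⇔ (Neither.old-⇔ ends A s t) (connected? G′ _ _ _) (connected? G _ _ _)
      χ-oi : ∀ A → χ′ (outside ∷ inside ∷ A) ≡ χ (outside ∷ A)
      χ-oi A = does-⇔ (Second.old-⇔ ends A s t) (connected? G′ _ _ _) (connected? G _ _ _)
      χ-io : ∀ A → χ′ (inside ∷ outside ∷ A) ≡ χ (outside ∷ A)
      χ-io A = does-⇔ (First.old-⇔ ends A s t) (connected? G′ _ _ _) (connected? G _ _ _)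
      χ-ii : ∀ A → χ′ (inside ∷ inside ∷ A) ≡ χ (inside ∷ A)
      χ-ii A = does-⇔ (Both.old-⇔ ends A s t) (connected? G′ _ _ _) (connected? G _ _ _)

    Z-joined-series : Z-joined q G′ w′ (suc s) (suc t) ≡ (q + α + β) * Z-joined q G w s t
    Z-joined-series = trans (Z-joined-∑ q (subdivide ends) w′ (suc s) (suc t))
      (trans (∑-series χ χ′ χ-oo χ-oi χ-io χ-ii) (cong ((q + α + β) *_) (sym (Z-joined-∑ q ends w s t))))

    Z-separated-series : Z-separated q G′ w′ (suc s) (suc t) ≡ (q + α + β) * Z-separated q G w s t
    Z-separated-series = trans (Z-separated-∑ q (subdivide ends) w′ (suc s) (suc t))
      (trans (∑-series (not ∘ χ) (not ∘ χ′) (cong not ∘ χ-oo) (cong not ∘ χ-oi) (cong not ∘ χ-io) (cong not ∘ χ-ii))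
             (cong ((q + α + β) *_) (sym (Z-separated-∑ q ends w s t))))

-- Parallel composition

module _ (ends : Ends n m) (s t : Fin n) (A : Subset m) where

  private
    G  = graph ends
    G′ = graph ((s , t) F.∷ ends)

    grow : ∀ {b x y} → Connected G A x y → Connected G′ (b ∷ A) x y
    grow = Eq.map λ (e , e∈A , eq) → suc e , there e∈A , eq

    shrink : ∀ {x y} → Connected G′ (outside ∷ A) x y → Connected G A x y
    shrink = Eq.map λ { (suc e , there e∈A , eq) → e , e∈A , eq }

  inside-joined : Connected G′ (inside ∷ A) s t
  inside-joined = Eq.return (zero , here , refl)

  outside-⇔ : ∀ x y → Connected G′ (outside ∷ A) x y ⇔ Connected G A x y
  outside-⇔ x y = mk⇔ shrink grow

  κ-outside : κ G′ (outside ∷ A) ≡ κ G A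
  κ-outside = classes-unique (proj₂ (components G′ (outside ∷ A)))
    (classes-map id (λ b → b , refl) shrink grow (proj₂ (components G A)))

  κ-inside-joined : Connected G A s t → κ G′ (inside ∷ A) ≡ κ G A
  κ-inside-joined s~t = classes-unique (proj₂ (components G′ (inside ∷ A)))
    (classes-map id (λ b → b , refl) shrink′ grow (proj₂ (components G A)))
    where
    shrink′ : ∀ {x y} → Connected G′ (inside ∷ A) x y → Connected G A x y
    shrink′ = Eq.fold (Eq.isEquivalence _) λ
      { (zero  , _         , refl) → s~t
      ; (suc e , there e∈A , eq)   → Eq.return (e , e∈A , eq) }

  -- Relative to the classes of inside ∷ A, that of s and t falls into two,
  -- of which the one of s gets the number zero.

  κ-inside-separated : ¬ Connected G A s t → κ G A ≡ suc (κ G′ (inside ∷ A))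
  κ-inside-separated s≁t = classes-unique (proj₂ (components G A)) record
    { class      = λ x → split x (connected? G A x s)
    ; surjective = λ { zero → s , split-yes (Eq.reflexive _)
                     ; (suc c) → let x , eq = D.surjective c in hit x eq (connected? G A x s) }
    ; sound      = λ x~y → split-cong x~y (connected? G A _ s) (connected? G A _ s)
    ; complete   = split-complete (connected? G A _ s) (connected? G A _ s)
    }
    where
    module C = Classes (proj₂ (components G A))
    module D = Classes (proj₂ (components G′ (inside ∷ A)))
    _⨾_ : ∀ {x y z} → Connected G A x y → Connected G A y z → Connected G A x z
    _⨾_ = Eq.transitive _
    sy : ∀ {x y} → Connected G A x y → Connected G A y x
    sy = Eq.symmetric _

    split : ∀ x → Dec (Connected G A x s) → Fin (suc (κ G′ (inside ∷ A)))
    split x (yes _) = zero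
    split x (no  _) = suc (D.class x)

    split-yes : ∀ {x} → Connected G A x s → split x (connected? G A x s) ≡ zero
    split-yes {x} x~s with connected? G A x s
    ... | yes _  = refl
    ... | no x≁s = ⊥-elim (x≁s x~s)

    split-no : ∀ {x} → ¬ Connected G A x s → split x (connected? G A x s) ≡ suc (D.class x)
    split-no {x} x≁s with connected? G A x s
    ... | yes x~s = ⊥-elim (x≁s x~s)
    ... | no _    = refl

    -- If the representative `x` is joined to `s`, its class under `inside ∷ A` also contains `t`,
    -- which is separated from `s` in `A` and can represent the class instead.
    hit : ∀ {c} x → D.class x ≡ c → Dec (Connected G A x s) → ∃ λ y → split y (connected? G A y s) ≡ suc c
    hit x eq (no x≁s)  = x , trans (split-no x≁s) (cong suc eq)
    hit x eq (yes x~s) = t , trans (split-no (s≁t ∘ sy))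
      (cong suc (trans (sym (D.sound (Eq.transitive _ (grow x~s) inside-joined))) eq))

    split-cong : ∀ {x y} → Connected G A x y → (d : Dec (Connected G A x s)) (d′ : Dec (Connected G A y s)) →
                 split x d ≡ split y d′
    split-cong x~y (yes _)   (yes _)   = refl
    split-cong x~y (yes x~s) (no y≁s)  = ⊥-elim (y≁s (sy x~y ⨾ x~s))
    split-cong x~y (no x≁s)  (yes y~s) = ⊥-elim (x≁s (x~y ⨾ y~s))
    split-cong x~y (no _)    (no _)    = cong suc (D.sound (grow x~y))

    -- The class of `s` is absorbed into that of `t`, so this function is constant along the new
    -- edge as well. Away from the class of `s` it is `C.class`; hence vertices there that
    -- `inside ∷ A` connects were connected by `A` already.
    merged : ∀ x → Dec (Connected G A x s) → Fin (κ G A)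
    merged x (yes _) = C.class t
    merged x (no  _) = C.class x

    merged-cong : ∀ {x y} → Connected G A x y → (d : Dec (Connected G A x s)) (d′ : Dec (Connected G A y s)) →
                  merged x d ≡ merged y d′
    merged-cong x~y (yes _)   (yes _)   = refl
    merged-cong x~y (yes x~s) (no y≁s)  = ⊥-elim (y≁s (sy x~y ⨾ x~s))
    merged-cong x~y (no x≁s)  (yes y~s) = ⊥-elim (x≁s (x~y ⨾ y~s))
    merged-cong x~y (no _)    (no _)    = C.sound x~y

    merged-link : (d : Dec (Connected G A s s)) (d′ : Dec (Connected G A t s)) → merged s d ≡ merged t d′
    merged-link (yes _)  (yes _) = refl
    merged-link (yes _)  (no _)  = refl
    merged-link (no s≁s) _       = ⊥-elim (s≁s (Eq.reflexive _))

    merged-sound : ∀ {x y} → Connected G′ (inside ∷ A) x y →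
                   merged x (connected? G A x s) ≡ merged y (connected? G A y s)
    merged-sound = Eq.gfold isEquivalence (λ x → merged x (connected? G A x s)) λ
      { (zero  , _         , refl) → merged-link (connected? G A _ s) (connected? G A _ s)
      ; (suc e , there e∈A , eq)   → merged-cong (Eq.return (e , e∈A , eq)) (connected? G A _ s) (connected? G A _ s) }

    merged-no : ∀ {x} → ¬ Connected G A x s → merged x (connected? G A x s) ≡ C.class x
    merged-no {x} x≁s with connected? G A x s
    ... | yes x~s = ⊥-elim (x≁s x~s)
    ... | no _    = refl

    split-complete : ∀ {x y} (d : Dec (Connected G A x s)) (d′ : Dec (Connected G A y s)) →
                     split x d ≡ split y d′ → Connected G A x y
    split-complete (yes x~s) (yes y~s) _  = x~s ⨾ sy y~s
    split-complete (no x≁s)  (no y≁s)  eq = C.complete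
      (trans (sym (merged-no x≁s)) (trans (merged-sound (D.complete (suc-injective eq))) (merged-no y≁s)))

module _ (q : ℚ) (ends : Ends n m) (w : Fin m → ℚ) (s t : Fin n) (w₀ : ℚ) where

  private
    G  = graph ends
    G′ = graph ((s , t) F.∷ ends)
    w′ : Fin (suc m) → ℚ
    w′ = w₀ F.∷ w
    T  = term q G w
    T′ = term q G′ w′
    χ  = joined? q ends w s t
    χ′ = joined? q ((s , t) F.∷ ends) w′ s t

    T-outside : ∀ A → T′ (outside ∷ A) ≡ T A
    T-outside A = cong₂ _*_ (weight-outside w′ A) (cong (q ^_) (κ-outside ends s t A))

    χ-outside : ∀ A → χ′ (outside ∷ A) ≡ χ A
    χ-outside A = does-⇔ (outside-⇔ ends s t A s t) (connected? G′ _ _ _) (connected? G _ _ _)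

    χ-inside : ∀ A → χ′ (inside ∷ A) ≡ true
    χ-inside A = dec-true (connected? G′ _ _ _) (inside-joined ends s t A)

    -- If `s` and `t` are separated, the new edge lowers the number of components by one. The factor
    -- `q` on the left makes up for this, so that no power of `q` has to be divided.
    T-inside : ∀ A → q * T′ (inside ∷ A) ≡ w₀ * (q * mask (χ A) (T A) + mask (not (χ A)) (T A))
    T-inside A = by (connected? G A s t)
      where
      open ≡-Reasoning
      open +-*-Solver
      by : (d : Dec (Connected G A s t)) →
           q * T′ (inside ∷ A) ≡ w₀ * (q * mask (does d) (T A) + mask (not (does d)) (T A))
      by (yes s~t) = begin
        q * (weight w′ (inside ∷ A) * q ^ κ G′ (inside ∷ A))
          ≡⟨ cong (q *_) (cong₂ _*_ (weight-inside w′ A) (cong (q ^_) (κ-inside-joined ends s t A s~t))) ⟩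
        q * (w₀ * weight w A * q ^ κ G A)
          ≡⟨ solve 4 (λ q w x y → q :* (w :* x :* y) := w :* (q :* (x :* y) :+ con 0ℚ)) refl q w₀ (weight w A) (q ^ κ G A) ⟩
        w₀ * (q * (weight w A * q ^ κ G A) + 0ℚ) ∎
      by (no s≁t) = begin
        q * (weight w′ (inside ∷ A) * q ^ κ G′ (inside ∷ A))
          ≡⟨ cong (λ x → q * (x * q ^ κ G′ (inside ∷ A))) (weight-inside w′ A) ⟩
        q * (w₀ * weight w A * q ^ κ G′ (inside ∷ A))
          ≡⟨ solve 4 (λ q w x y → q :* (w :* x :* y) := w :* (q :* con 0ℚ :+ x :* (q :* y))) refl q w₀ (weight w A) (q ^ κ G′ (inside ∷ A)) ⟩
        w₀ * (q * 0ℚ + weight w A * (q ^ suc (κ G′ (inside ∷ A))))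
          ≡⟨ cong (λ k → w₀ * (q * 0ℚ + weight w A * q ^ k)) (κ-inside-separated ends s t A s≁t) ⟨
        w₀ * (q * 0ℚ + weight w A * q ^ κ G A) ∎

    J′ = ∑ (λ A → mask (χ A) (T A))
    S′ = ∑ (λ A → mask (not (χ A)) (T A))

  Z-separated-parallel : Z-separated q G′ w′ s t ≡ Z-separated q G w s t
  Z-separated-parallel = begin
    Z-separated q G′ w′ s t
      ≡⟨ Z-separated-∑ q ((s , t) F.∷ ends) w′ s t ⟩
    ∑ (λ A → mask (not (χ′ (outside ∷ A))) (T′ (outside ∷ A))) + ∑ (λ A → mask (not (χ′ (inside ∷ A))) (T′ (inside ∷ A)))
      ≡⟨ cong₂ _+_ (∑-cong λ A → cong₂ (mask ∘ not) (χ-outside A) (T-outside A))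
                   (trans (∑-cong λ A → trans (cong (λ b → mask (not b) (T′ (inside ∷ A))) (χ-inside A))
                                              (sym (ℚ.*-zeroˡ (T′ (inside ∷ A)))))
                          (trans (∑-* 0ℚ (T′ ∘ (inside ∷_))) (ℚ.*-zeroˡ (∑ (T′ ∘ (inside ∷_)))))) ⟩
    S′ + 0ℚ
      ≡⟨ ℚ.+-identityʳ S′ ⟩
    S′
      ≡⟨ Z-separated-∑ q ends w s t ⟨
    Z-separated q G w s t ∎
    where open ≡-Reasoning

  Z-joined-parallel : q * Z-joined q G′ w′ s t ≡
                      q * Z-joined q G w s t + w₀ * (q * Z-joined q G w s t + Z-separated q G w s t)
  Z-joined-parallel = begin
    q * Z-joined q G′ w′ s t
      ≡⟨ cong (q *_) (Z-joined-∑ q ((s , t) F.∷ ends) w′ s t) ⟩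
    q * (∑ (λ A → mask (χ′ (outside ∷ A)) (T′ (outside ∷ A))) + ∑ (λ A → mask (χ′ (inside ∷ A)) (T′ (inside ∷ A))))
      ≡⟨ cong (q *_) (cong₂ _+_ (∑-cong λ A → cong₂ mask (χ-outside A) (T-outside A))
                                (∑-cong λ A → cong (λ b → mask b (T′ (inside ∷ A))) (χ-inside A))) ⟩
    q * (J′ + ∑ (T′ ∘ (inside ∷_)))
      ≡⟨ ℚ.*-distribˡ-+ q J′ _ ⟩
    q * J′ + q * ∑ (T′ ∘ (inside ∷_))
      ≡⟨ cong (_+_ (q * J′)) (trans (sym (∑-* q (T′ ∘ (inside ∷_)))) (trans (∑-cong T-inside) (∑-* w₀ (λ A → q * mask (χ A) (T A) + mask (not (χ A)) (T A))))) ⟩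
    q * J′ + w₀ * ∑ (λ A → q * mask (χ A) (T A) + mask (not (χ A)) (T A))
      ≡⟨ cong (λ x → q * J′ + w₀ * x) (trans (∑-+ (λ A → q * mask (χ A) (T A)) (λ A → mask (not (χ A)) (T A)))
                                             (cong (_+ S′) (∑-* q (λ A → mask (χ A) (T A))))) ⟩
    q * J′ + w₀ * (q * J′ + S′)
      ≡⟨ cong₂ (λ J′ S′ → q * J′ + w₀ * (q * J′ + S′)) (Z-joined-∑ q ends w s t) (Z-separated-∑ q ends w s t) ⟨
    q * Z-joined q G w s t + w₀ * (q * Z-joined q G w s t + Z-separated q G w s t) ∎
    where open ≡-Reasoning

-- Networks and their effective weights

-‿involutive : ∀ x → - - x ≡ x
-‿involutive = solve 1 (λ x → :- (:- x) := x) refl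
  where open +-*-Solver

*-≢0 : ∀ {x y} → x ≢ 0ℚ → y ≢ 0ℚ → x * y ≢ 0ℚ
*-≢0 {x} {y} x≢0 y≢0 xy≡0 = y≢0 (begin
  y                ≡⟨ ℚ.*-identityˡ y ⟨
  1ℚ * y           ≡⟨ cong (_* y) (ℚ.*-inverseˡ x) ⟨
  1/ x * x * y     ≡⟨ ℚ.*-assoc (1/ x) x y ⟩
  1/ x * (x * y)   ≡⟨ cong (1/ x *_) xy≡0 ⟩
  1/ x * 0ℚ        ≡⟨ ℚ.*-zeroʳ (1/ x) ⟩
  0ℚ               ∎)
  where
  open ≡-Reasoning
  instance _ = ≢-nonZero x≢0

-- y is 1 plus the effective weight between the ends of edge e.

record Network (q : ℚ) (ends : Ends n m) (ŵ : Fin m → ℚ) (e : Fin m) (y : ℚ) : Set where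
  s = proj₁ (ends e)
  t = proj₂ (ends e)
  field
    plane       : Plane ends
    distinct    : s ≢ t
    separated≢0 : Z-separated q (graph ends) ŵ s t ≢ 0ℚ
    effective   : q * Z-joined q (graph ends) ŵ s t + Z-separated q (graph ends) ŵ s t ≡
                  y * Z-separated q (graph ends) ŵ s t

-- Writing J for q Z_st and S for Z_s|t, the new edge turns J into J + w₀ (J + S) and keeps S. So J
-- + S is multiplied by 1 + w₀, and with it y.
effective-parallel : ∀ q y (ends : Ends n m) w s t w₀ →
  let Z = Z-separated q (graph ends) w s t
      Z′ = Z-separated q (graph ((s , t) F.∷ ends)) (w₀ F.∷ w) s t in
  q * Z-joined q (graph ends) w s t + Z ≡ y * Z →
  q * Z-joined q (graph ((s , t) F.∷ ends)) (w₀ F.∷ w) s t + Z′ ≡ y * (1ℚ + w₀) * Z′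
effective-parallel q y ends w s t w₀ eq = begin
  q * Z-joined q (graph ((s , t) F.∷ ends)) (w₀ F.∷ w) s t + Z-separated q (graph ((s , t) F.∷ ends)) (w₀ F.∷ w) s t
    ≡⟨ cong₂ _+_ (Z-joined-parallel q ends w s t w₀) (Z-separated-parallel q ends w s t w₀) ⟩
  (J₀ + w₀ * (J₀ + S₀)) + S₀
    ≡⟨ solve 3 (λ J w S → (J :+ w :* (J :+ S)) :+ S := (con 1ℚ :+ w) :* (J :+ S)) refl J₀ w₀ S₀ ⟩
  (1ℚ + w₀) * (J₀ + S₀)
    ≡⟨ cong ((1ℚ + w₀) *_) eq ⟩
  (1ℚ + w₀) * (y * S₀)
    ≡⟨ solve 3 (λ w y S → w :* (y :* S) := y :* w :* S) refl (1ℚ + w₀) y S₀ ⟩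
  y * (1ℚ + w₀) * S₀
    ≡⟨ cong (y * (1ℚ + w₀) *_) (Z-separated-parallel q ends w s t w₀) ⟨
  y * (1ℚ + w₀) * Z-separated q (graph ((s , t) F.∷ ends)) (w₀ F.∷ w) s t ∎
  where
  open ≡-Reasoning
  open +-*-Solver
  J₀ = q * Z-joined q (graph ends) w s t
  S₀ = Z-separated q (graph ends) w s t

network-parallel : {ends : Ends n m} {ŵ : Fin m → ℚ} {e : Fin m} → Network q ends ŵ e y → ∀ w₀ →
                   Network q (parallel ends e) (w₀ F.∷ ŵ) (suc e) (y * (1ℚ + w₀))
network-parallel {q = q} {y = y} {ends = ends} {ŵ} {e} net w₀ = record
  { plane       = parallel-plane plane e
  ; distinct    = distinct
  ; separated≢0 = separated≢0 ∘ trans (sym (Z-separated-parallel q ends ŵ s t w₀))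
  ; effective   = effective-parallel q y ends ŵ s t w₀ effective
  }
  where open Network net

noWeights : Fin 0 → ℚ
noWeights ()

-- The edge is added in parallel to the edgeless graph on two vertices, where Z_st is 0 and Z_s|t is
-- q², so that y is 1.
network-single : q ≢ 0ℚ → ∀ α → Network q single (α F.∷ noWeights) zero (1ℚ * (1ℚ + α))
network-single {q} q≢0 α = record
  { plane       = single-plane
  ; distinct    = λ ()
  ; separated≢0 = λ eq → *-≢0 q≢0 q≢0 (begin
      q * q ≡⟨ solve 1 (λ q → q :* q := con 1ℚ :* (q :* (q :* con 1ℚ)) :+ con 0ℚ) refl q ⟩
      Z-separated q (graph (edgeless {2})) noWeights zero (suc zero)
        ≡⟨ Z-separated-parallel q (edgeless {2}) noWeights zero (suc zero) α ⟨
      Z-separated q (graph single) (α F.∷ noWeights) zero (suc zero)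
        ≡⟨ eq ⟩
      0ℚ ∎)
  ; effective   = effective-parallel q 1ℚ (edgeless {2}) noWeights zero (suc zero) α
      (solve 2 (λ q Z → q :* con 0ℚ :+ Z := con 1ℚ :* Z) refl q _)
  }
  where
  open ≡-Reasoning
  open +-*-Solver

-- Both partition functions are multiplied by q + α + β, which leaves `y` unchanged. The terminals
-- belong to an edge other than `zero`, as the subdivision destroys that one.
network-series : {ends : Ends n (suc m)} {ŵ : Fin (suc m) → ℚ} {e : Fin m} →
                 Network q ends ŵ (suc e) y → ∀ α β → q + α + β ≢ 0ℚ →
                 (q + α + β) * ŵ zero ≡ α * β →
                 Network q (subdivide ends) (α F.∷ β F.∷ (ŵ ∘ suc)) (suc (suc e)) y
network-series {q = q} {y = y} {ends = ends} {ŵ} {e} net α β c≢0 eq = record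
  { plane       = subdivide-plane plane
  ; distinct    = distinct ∘ suc-injective
  ; separated≢0 = λ S≡0 → *-≢0 c≢0 separated≢0 (trans (sym S≡) S≡0)
  ; effective   = begin
      q * Z-joined q G′ w′ (suc s) (suc t) + Z-separated q G′ w′ (suc s) (suc t)
        ≡⟨ cong₂ (λ J S → q * J + S) J≡ S≡ ⟩
      q * (c * J₀) + c * S₀
        ≡⟨ solve 4 (λ q c J S → q :* (c :* J) :+ c :* S := c :* (q :* J :+ S)) refl q c J₀ S₀ ⟩
      c * (q * J₀ + S₀)
        ≡⟨ cong (c *_) effective ⟩
      c * (y * S₀)
        ≡⟨ solve 3 (λ c y S → c :* (y :* S) := y :* (c :* S)) refl c y S₀ ⟩
      y * (c * S₀)
        ≡⟨ cong (y *_) S≡ ⟨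
      y * Z-separated q G′ w′ (suc s) (suc t) ∎
  }
  where
  open Network net
  open ≡-Reasoning
  open +-*-Solver
  G′ = graph (subdivide ends)
  w′ = α F.∷ β F.∷ (ŵ ∘ suc)
  c  = q + α + β
  J₀ = Z-joined q (graph ends) ŵ s t
  S₀ = Z-separated q (graph ends) ŵ s t
  J≡ = Z-joined-series q ends ŵ α β eq s t
  S≡ = Z-separated-series q ends ŵ α β eq s t

record Implementable (q : ℚ) (αs : List ℚ) (y : ℚ) (ℓ : ℕ) : Set where
  field
    {#V #E}  : ℕ
    {ends}   : Ends #V #E
    {ŵ}      : Fin #E → ℚ
    {e}      : Fin #E
    network  : Network q ends ŵ e y
    weights  : ∀ e → ŵ e ∈ αs
    size-≡   : #V ℕ.+ #E ≡ ℓ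

implementable-single : ∀ {α} → q ≢ 0ℚ → α ∈ αs → Implementable q αs (1ℚ + α) 3
implementable-single {q} {α = α} q≢0 α∈ = record
  { network = subst (Network q single (α F.∷ noWeights) zero) (ℚ.*-identityˡ (1ℚ + α)) (network-single q≢0 α)
  ; weights = λ { zero → α∈ }
  ; size-≡  = refl
  }

implementable-edge : ∀ {α} → α ∈ αs → Implementable q αs y ℓ → Implementable q αs (y * (1ℚ + α)) (suc ℓ)
implementable-edge α∈ I = record
  { network = network-parallel network _
  ; weights = λ { zero → α∈ ; (suc e) → weights e }
  ; size-≡  = trans (ℕ.+-suc #V #E) (cong suc size-≡)
  }
  where open Implementable I

-- The effective weight of a path of k + 1 edges of weight α is - drop k.

module Path {q α : ℚ} (q<0 : q < 0ℚ) (α<0 : α < 0ℚ) where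

  private instance
    -q>0 : Positive (- q)
    -q>0 = ℚ.positive (ℚ.neg-antimono-< q<0)
    -α>0 : Positive (- α)
    -α>0 = ℚ.positive (ℚ.neg-antimono-< α<0)

  private
    -- This is the series law for the weights - d and α with all signs reversed. The denominator is
    -- a sum of positive numbers, so the law can be solved and the result is again positive.
    next : ∀ d → .{{Positive d}} → Σ ℚ λ d′ → Positive d′ × (- q + - α + d) * d′ ≡ - α * d
    next d = - α * d * 1/ c , ℚ.pos*pos⇒pos (- α * d) (1/ c) , (begin
      c * (- α * d * 1/ c)   ≡⟨ solve 3 (λ c x i → c :* (x :* i) := x :* (c :* i)) refl c (- α * d) (1/ c) ⟩
      - α * d * (c * 1/ c)   ≡⟨ cong (- α * d *_) (ℚ.*-inverseʳ c) ⟩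
      - α * d * 1ℚ           ≡⟨ ℚ.*-identityʳ (- α * d) ⟩
      - α * d                ∎)
      where
      open ≡-Reasoning
      open +-*-Solver
      c = - q + - α + d
      instance
        -q-α>0 = ℚ.pos+pos⇒pos (- q) (- α)
        c>0 = ℚ.pos+pos⇒pos (- q + - α) d
        c≢0 = ℚ.pos⇒nonZero c
        αd>0 = ℚ.pos*pos⇒pos (- α) d
        1/c>0 = ℚ.1/pos⇒pos c

    positives : ℕ → Σ ℚ Positive
    positives zero    = - α , -α>0
    positives (suc k) = let d , d>0 = positives k ; d′ , d′>0 , _ = next d {{d>0}} in d′ , d′>0

  abstract
    drop : ℕ → ℚ
    drop k = proj₁ (positives k)

    drop-zero : drop 0 ≡ - α
    drop-zero = refl

    drop-positive : ∀ k → 0ℚ < drop k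
    drop-positive k = ℚ.positive⁻¹ (drop k) {{proj₂ (positives k)}}

    drop-suc : ∀ k → (- q + - α + drop k) * drop (suc k) ≡ - α * drop k
    drop-suc k = proj₂ (proj₂ (next (drop k) {{proj₂ (positives k)}}))

  private
    denominator≢0 : ∀ k → q + - drop k + α ≢ 0ℚ
    denominator≢0 k eq = ℚ.<⇒≢ (ℚ.+-mono-< (ℚ.+-mono-< q<0 (ℚ.neg-antimono-< (drop-positive k))) α<0) eq

    series : ∀ k → (q + - drop k + α) * - drop (suc k) ≡ - drop k * α
    series k = begin
      (q + - drop k + α) * - drop (suc k)
        ≡⟨ solve 4 (λ q a d d′ → (q :+ :- d :+ a) :* :- d′ := (:- q :+ :- a :+ d) :* d′) refl q α (drop k) (drop (suc k)) ⟩
      (- q + - α + drop k) * drop (suc k)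
        ≡⟨ drop-suc k ⟩
      - α * drop k
        ≡⟨ solve 2 (λ a d → :- a :* d := :- d :* a) refl α (drop k) ⟩
      - drop k * α ∎
      where
      open ≡-Reasoning
      open +-*-Solver

    -- Edge `zero` carries the effective weight of a path still to be unfolded, which need not
    -- belong to `αs`; all other weights do.
    record Unfinished (αs : List ℚ) (k : ℕ) (y : ℚ) (ℓ : ℕ) : Set where
      field
        {#V #E}  : ℕ
        {ends}   : Ends #V (suc #E)
        {ŵ}      : Fin (suc #E) → ℚ
        {e}      : Fin #E
        network  : Network q ends ŵ (suc e) y
        head     : ŵ zero ≡ - drop k
        weights  : ∀ e → ŵ (suc e) ∈ αs
        size-≡   : #V ℕ.+ suc #E ≡ ℓ

    start : Implementable q αs y ℓ → ∀ k → Unfinished αs k (y * (1ℚ - drop k)) (suc ℓ)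
    start I k = record
      { network = network-parallel network (- drop k)
      ; head    = refl
      ; weights = weights
      ; size-≡  = trans (ℕ.+-suc #V #E) (cong suc size-≡)
      }
      where open Implementable I

    -- Each step splits edge `zero` into one edge of weight α and one that stands for a path shorter
    -- by one edge, at the price of one vertex and one edge. At k = 0 the remaining weight - drop 0
    -- is α itself.
    finish : α ∈ αs → Unfinished αs k y ℓ → Implementable q αs y (ℓ ℕ.+ 2 ℕ.* k)
    finish {k = zero} {ℓ = ℓ} α∈ U = record
      { network = network
      ; weights = λ { zero → subst (_∈ _) (sym (trans head (trans (cong -_ drop-zero) (-‿involutive α)))) α∈
                    ; (suc e) → weights e }
      ; size-≡  = trans size-≡ (sym (ℕ.+-identityʳ ℓ))
      }
      where open Unfinished U
    finish {k = suc k} {ℓ = ℓ} α∈ U = subst (Implementable q _ _) size-suc (finish {k = k} α∈ record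
      { network = network-series network (- drop k) α (denominator≢0 k)
                    (trans (cong ((q + - drop k + α) *_) head) (series k))
      ; head    = refl
      ; weights = λ { zero → α∈ ; (suc e) → weights e }
      ; size-≡  = cong suc (trans (ℕ.+-suc #V (suc #E)) (cong suc size-≡))
      })
      where
      open Unfinished U
      size-suc : suc (suc ℓ) ℕ.+ 2 ℕ.* k ≡ ℓ ℕ.+ 2 ℕ.* suc k
      size-suc = trans (sym (trans (ℕ.+-suc ℓ _) (cong suc (ℕ.+-suc ℓ _))))
                       (cong (ℓ ℕ.+_) (sym (ℕ.*-suc 2 k)))

  implementable-path : α ∈ αs → ∀ k → Implementable q αs y ℓ →
                       Implementable q αs (y * (1ℚ - drop k)) (suc ℓ ℕ.+ 2 ℕ.* k)
  implementable-path α∈ k I = finish α∈ (start I k)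

implementable⇒implements : Implementable q αs y ℓ →
  Σ Graph λ Υ → Σ (Graph.Vertex Υ) λ s → Σ (Graph.Vertex Υ) λ t → Σ (Graph.Edge Υ → ℚ) λ ŵ →
  PlanarWithTerminals Υ s t × (∀ e → ŵ e ∈ αs) × Implements q Υ ŵ s t (y - 1ℚ) × size Υ ≡ ℓ
implementable⇒implements {q} {y = y} I =
  graph ends , s , t , ŵ , plane⇒planarWithTerminals plane _ distinct , weights ,
  (separated≢0 , (begin
    y - 1ℚ                      ≡⟨ ℚ.*-identityʳ _ ⟨
    (y - 1ℚ) * 1ℚ               ≡⟨ cong ((y - 1ℚ) *_) (ℚ.*-inverseʳ S₀) ⟨
    (y - 1ℚ) * (S₀ * 1/ S₀)     ≡⟨ solve 3 (λ y S i → (y :- con 1ℚ) :* (S :* i) := (y :* S :- S) :* i) refl y S₀ (1/ S₀) ⟩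
    (y * S₀ - S₀) * 1/ S₀       ≡⟨ cong (λ x → (x - S₀) * 1/ S₀) effective ⟨
    (q * J₀ + S₀ - S₀) * 1/ S₀  ≡⟨ solve 3 (λ J S i → (J :+ S :- S) :* i := J :* i) refl (q * J₀) S₀ (1/ S₀) ⟩
    q * J₀ ÷ S₀                 ∎)) ,
  size-≡
  where
  open Implementable I
  open Network network
  open ≡-Reasoning
  open +-*-Solver
  J₀ = Z-joined q (graph ends) ŵ s t
  S₀ = Z-separated q (graph ends) ŵ s t
  instance _ = ≢-nonZero separated≢0

-- Rational inequalities

≤-by : 0ℚ ≤ ε → y ≡ x + ε → x ≤ y
≤-by {ε} {y} {x} ε≥0 eq = begin
  x        ≡⟨ ℚ.+-identityʳ x ⟨
  x + 0ℚ   ≤⟨ ℚ.+-monoʳ-≤ x ε≥0 ⟩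
  x + ε    ≡⟨ eq ⟨
  y        ∎
  where open ℚ.≤-Reasoning

<-by : 0ℚ < ε → y ≡ x + ε → x < y
<-by {ε} {y} {x} ε>0 eq = begin-strict
  x        ≡⟨ ℚ.+-identityʳ x ⟨
  x + 0ℚ   <⟨ ℚ.+-monoʳ-< x ε>0 ⟩
  x + ε    ≡⟨ eq ⟨
  y        ∎
  where open ℚ.≤-Reasoning

≤⇒0≤- : x ≤ y → 0ℚ ≤ y - x
≤⇒0≤- {x} {y} x≤y = subst (_≤ y - x) (ℚ.+-inverseʳ x) (ℚ.+-monoˡ-≤ (- x) x≤y)

<⇒0<- : x < y → 0ℚ < y - x
<⇒0<- {x} {y} x<y = subst (_< y - x) (ℚ.+-inverseʳ x) (ℚ.+-monoˡ-< (- x) x<y)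

0≤+ : 0ℚ ≤ x → 0ℚ ≤ y → 0ℚ ≤ x + y
0≤+ = ℚ.+-mono-≤

0≤* : 0ℚ ≤ x → 0ℚ ≤ y → 0ℚ ≤ x * y
0≤* {x} {y} x≥0 y≥0 = ℚ.nonNegative⁻¹ (x * y)
  {{ℚ.nonNeg*nonNeg⇒nonNeg x {{ℚ.nonNegative x≥0}} y {{ℚ.nonNegative y≥0}}}}

0<* : 0ℚ < x → 0ℚ < y → 0ℚ < x * y
0<* {x} {y} x>0 y>0 = ℚ.positive⁻¹ (x * y) {{ℚ.pos*pos⇒pos x {{ℚ.positive x>0}} y {{ℚ.positive y>0}}}}

*-monoˡ : 0ℚ ≤ z → x ≤ y → z * x ≤ z * y
*-monoˡ {z} z≥0 = ℚ.*-monoˡ-≤-nonNeg z {{ℚ.nonNegative z≥0}}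

*-monoʳ : 0ℚ ≤ z → x ≤ y → x * z ≤ y * z
*-monoʳ {z} z≥0 = ℚ.*-monoʳ-≤-nonNeg z {{ℚ.nonNegative z≥0}}

*-cancelˡ : 0ℚ < z → z * x ≤ z * y → x ≤ y
*-cancelˡ {z} z>0 = ℚ.*-cancelˡ-≤-pos z {{ℚ.positive z>0}}

*-cancelʳ : 0ℚ < z → x * z ≤ y * z → x ≤ y
*-cancelʳ {z} z>0 = ℚ.*-cancelʳ-≤-pos z {{ℚ.positive z>0}}

0≤1 : 0ℚ ≤ 1ℚ
0≤1 = ℚ.nonNegative⁻¹ 1ℚ

0<1 : 0ℚ < 1ℚ
0<1 = ℚ.positive⁻¹ 1ℚ

-- The Archimedean property and powers

fromℕ : ℕ → ℚ
fromℕ zero    = 0ℚ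
fromℕ (suc n) = 1ℚ + fromℕ n

0≤fromℕ : ∀ n → 0ℚ ≤ fromℕ n
0≤fromℕ zero    = ℚ.≤-refl
0≤fromℕ (suc n) = 0≤+ 0≤1 (0≤fromℕ n)

toℚᵘ-fromℕ : ∀ n → toℚᵘ (fromℕ n) ℚᵘ.≃ mkℚᵘ (+ n) 0
toℚᵘ-fromℕ zero    = ℚᵘ.≃-refl
toℚᵘ-fromℕ (suc n) = begin
  toℚᵘ (1ℚ + fromℕ n)                 ≈⟨ ℚ.toℚᵘ-homo-+ 1ℚ (fromℕ n) ⟩
  mkℚᵘ (+ 1) 0 ℚᵘ.+ toℚᵘ (fromℕ n)    ≈⟨ ℚᵘ.+-congʳ (mkℚᵘ (+ 1) 0) (toℚᵘ-fromℕ n) ⟩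
  mkℚᵘ (+ 1) 0 ℚᵘ.+ mkℚᵘ (+ n) 0      ≈⟨ ℚᵘ.*≡* (cong (ℤ._* + 1) (cong (λ i → + 1 ℤ.+ i) (ℤ.*-identityʳ (+ n)))) ⟩
  mkℚᵘ (+ suc n) 0                    ∎
  where open ℚᵘ.≃-Reasoning

≤-fromℕ : ∀ x → ∃ λ n → x ≤ fromℕ n
≤-fromℕ x@(mkℚ i d _) = ℤ.∣ i ∣ , ℚ.toℚᵘ-cancel-≤ (ℚᵘ.≤-trans
  (ℚᵘ.*≤* (bound i))
  (ℚᵘ.≤-reflexive (ℚᵘ.≃-sym (toℚᵘ-fromℕ ℤ.∣ i ∣))))
  where
  bound : ∀ i → i ℤ.* + 1 ℤ.≤ + ℤ.∣ i ∣ ℤ.* + suc d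
  bound (+ n)    = subst₂ ℤ._≤_ (ℤ.pos-* n 1) (ℤ.pos-* n (suc d))
                     (ℤ.+≤+ (ℕ.*-monoʳ-≤ n (ℕ.s≤s ℕ.z≤n)))
  bound -[1+ n ] = ℤ.-≤+

archimedean : 0ℚ < x → ∀ y → ∃ λ n → y ≤ fromℕ n * x
archimedean {x} x>0 y = let n , y/x≤n = ≤-fromℕ (y * 1/ x) in n , (begin
  y              ≡⟨ ℚ.*-identityʳ y ⟨
  y * 1ℚ         ≡⟨ cong (y *_) (ℚ.*-inverseˡ x) ⟨
  y * (1/ x * x) ≡⟨ ℚ.*-assoc y (1/ x) x ⟨
  y * 1/ x * x   ≤⟨ *-monoʳ (ℚ.<⇒≤ x>0) y/x≤n ⟩
  fromℕ n * x    ∎)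
  where
  open ℚ.≤-Reasoning
  instance
    _ = ℚ.positive x>0
    _ = ℚ.pos⇒nonZero x

0≤^ : 0ℚ ≤ x → ∀ n → 0ℚ ≤ x ^ n
0≤^ x≥0 zero    = 0≤1
0≤^ x≥0 (suc n) = 0≤* x≥0 (0≤^ x≥0 n)

bernoulli : 0ℚ ≤ x → ∀ n → 1ℚ + fromℕ n * x ≤ (1ℚ + x) ^ n
bernoulli {x} x≥0 zero    = ℚ.≤-reflexive (solve 1 (λ x → con 1ℚ :+ con 0ℚ :* x := con 1ℚ) refl x)
  where open +-*-Solver
bernoulli {x} x≥0 (suc n) = begin
  1ℚ + (1ℚ + fromℕ n) * x
    ≤⟨ ≤-by (0≤* (0≤* (0≤fromℕ n) x≥0) x≥0)
         (solve 2 (λ n x → (con 1ℚ :+ x) :* (con 1ℚ :+ n :* x) := con 1ℚ :+ (con 1ℚ :+ n) :* x :+ n :* x :* x) refl (fromℕ n) x) ⟩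
  (1ℚ + x) * (1ℚ + fromℕ n * x)
    ≤⟨ *-monoˡ (0≤+ 0≤1 x≥0) (bernoulli x≥0 n) ⟩
  (1ℚ + x) * (1ℚ + x) ^ n ∎
  where
  open ℚ.≤-Reasoning
  open +-*-Solver

-- Induction works because (1 - x) (1 + (n + 1) x) falls short of 1 + n x by (n + 1) x². The lemma
-- bounds powers of 1 - x from above without a quotient.
bernoulli⁻ : 0ℚ ≤ x → x ≤ 1ℚ → ∀ n → (1ℚ - x) ^ n * (1ℚ + fromℕ n * x) ≤ 1ℚ
bernoulli⁻ {x} x≥0 x≤1 zero    = ℚ.≤-reflexive (solve 1 (λ x → con 1ℚ :* (con 1ℚ :+ con 0ℚ :* x) := con 1ℚ) refl x)
  where open +-*-Solver
bernoulli⁻ {x} x≥0 x≤1 (suc n) = begin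
  (1ℚ - x) * p * (1ℚ + (1ℚ + N) * x)
    ≤⟨ ≤-by (0≤+ (0≤* p≥0 (0≤* x≥0 x≥0))
               (0≤* (0≤* p≥0 (0≤fromℕ n)) (0≤* x≥0 x≥0)))
         (solve 3 (λ p N x →
            p :* (con 1ℚ :+ N :* x) :=
            (con 1ℚ :- x) :* p :* (con 1ℚ :+ (con 1ℚ :+ N) :* x) :+ (p :* (x :* x) :+ p :* N :* (x :* x))) refl p N x)
     ⟩
  p * (1ℚ + N * x)
    ≤⟨ bernoulli⁻ x≥0 x≤1 n ⟩
  1ℚ ∎
  where
  open ℚ.≤-Reasoning
  open +-*-Solver
  p = (1ℚ - x) ^ n
  N = fromℕ n
  p≥0 = 0≤^ (≤⇒0≤- x≤1) n

power-vanishes : 0ℚ ≤ x → x < 1ℚ → ∀ y → ∃ λ n → x ^ n * y ≤ 1ℚ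
power-vanishes {x} x≥0 x<1 y =
  let n , y≤nh = archimedean (<⇒0<- x<1) y
      h = 1ℚ - x
      1-h≡x = solve 1 (λ x → con 1ℚ :- (con 1ℚ :- x) := x) refl x
  in n , (begin
    x ^ n * y                             ≤⟨ *-monoˡ (0≤^ x≥0 n) (ℚ.≤-trans y≤nh (≤-by 0≤1 (ℚ.+-comm 1ℚ (fromℕ n * h)))) ⟩
    x ^ n * (1ℚ + fromℕ n * h)            ≡⟨ cong (λ x → x ^ n * (1ℚ + fromℕ n * h)) 1-h≡x ⟨
    (1ℚ - h) ^ n * (1ℚ + fromℕ n * h)     ≤⟨ bernoulli⁻ (≤⇒0≤- (ℚ.<⇒≤ x<1)) (≤-by x≥0 (solve 1 (λ x → con 1ℚ := con 1ℚ :- x :+ x) refl x)) n ⟩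
    1ℚ                                    ∎)
  where
  open ℚ.≤-Reasoning
  open +-*-Solver

-- The exponent is a successor because the initial graph contains at least two parallel edges of
-- weight α₁.
power-grows : 1ℚ < x → ∀ y → ∃ λ n → y ≤ x ^ suc n
power-grows {x} x>1 y =
  let n , y≤nh = archimedean (<⇒0<- x>1) y
      h = x - 1ℚ
      h≥0 = ≤⇒0≤- (ℚ.<⇒≤ x>1)
  in n , (begin
    y                          ≤⟨ y≤nh ⟩
    fromℕ n * h                ≤⟨ ≤-by (0≤+ 0≤1 h≥0) (solve 2 (λ n h → con 1ℚ :+ (con 1ℚ :+ n) :* h := n :* h :+ (con 1ℚ :+ h)) refl (fromℕ n) h) ⟩
    1ℚ + fromℕ (suc n) * h     ≤⟨ bernoulli h≥0 (suc n) ⟩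
    (1ℚ + h) ^ suc n           ≡⟨ cong (_^ suc n) (solve 1 (λ x → con 1ℚ :+ (x :- con 1ℚ) := x) refl x) ⟩
    x ^ suc n                  ∎)
  where
  open ℚ.≤-Reasoning
  open +-*-Solver

^-monoˡ : 0ℚ ≤ x → x ≤ y → ∀ n → x ^ n ≤ y ^ n
^-monoˡ x≥0 x≤y zero    = ℚ.≤-refl
^-monoˡ {x} x≥0 x≤y (suc n) = ℚ.≤-trans (*-monoˡ x≥0 (^-monoˡ x≥0 x≤y n))
                                        (*-monoʳ (0≤^ (ℚ.≤-trans x≥0 x≤y) n) x≤y)

^-+ : ∀ x m n → x ^ (m ℕ.+ n) ≡ x ^ m * x ^ n
^-+ x zero    n = sym (ℚ.*-identityˡ (x ^ n))
^-+ x (suc m) n = trans (cong (x *_) (^-+ x m n)) (sym (ℚ.*-assoc x (x ^ m) (x ^ n)))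

^-* : ∀ x m n → x ^ (m ℕ.* n) ≡ (x ^ n) ^ m
^-* x zero    n = refl
^-* x (suc m) n = trans (^-+ x n (m ℕ.* n)) (cong (x ^ n *_) (^-* x m n))

2ℚ 4ℚ : ℚ
2ℚ = + 2 / 1
4ℚ = + 4 / 1

-- Geometric decay of the path weights

module PathBounds {q α : ℚ} (q<0 : q < 0ℚ) (α<0 : α < 0ℚ) where

  open Path q<0 α<0 public

  private
    Q = - q
    β = - α
    Q>0 : 0ℚ < Q
    Q>0 = ℚ.neg-antimono-< q<0
    β>0 : 0ℚ < β
    β>0 = ℚ.neg-antimono-< α<0
    Q+β>0 : 0ℚ < Q + β
    Q+β>0 = ℚ.+-mono-< Q>0 β>0
    instance
      Q+β-pos = ℚ.positive Q+β>0
      Q+β≢0 = ℚ.pos⇒nonZero (Q + β)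

    d≥0 : ∀ k → 0ℚ ≤ drop k
    d≥0 k = ℚ.<⇒≤ (drop-positive k)

  ratio : ℚ
  ratio = 1/ (Q + β) * β

  private
    ratio-* : (Q + β) * ratio ≡ β
    ratio-* = trans (sym (ℚ.*-assoc (Q + β) (1/ (Q + β)) β))
                    (trans (cong (_* β) (ℚ.*-inverseʳ (Q + β))) (ℚ.*-identityˡ β))

  ratio≥0 : 0ℚ ≤ ratio
  ratio≥0 = *-cancelˡ Q+β>0 (begin
    (Q + β) * 0ℚ      ≡⟨ ℚ.*-zeroʳ (Q + β) ⟩
    0ℚ                ≤⟨ ℚ.<⇒≤ β>0 ⟩
    β                 ≡⟨ ratio-* ⟨
    (Q + β) * ratio   ∎)
    where open ℚ.≤-Reasoning

  ratio<1 : ratio < 1ℚ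
  ratio<1 = ℚ.*-cancelˡ-<-nonNeg (Q + β) {{ℚ.nonNegative (ℚ.<⇒≤ Q+β>0)}} (begin-strict
    (Q + β) * ratio   ≡⟨ ratio-* ⟩
    β                 <⟨ <-by Q>0 (solve 2 (λ Q β → (Q :+ β) :* con 1ℚ := β :+ Q) refl Q β) ⟩
    (Q + β) * 1ℚ      ∎)
    where
    open ℚ.≤-Reasoning
    open +-*-Solver

  -- Discarding `drop k` from the denominator Q + β + drop k of the recurrence leaves the constant
  -- ratio β / (Q + β).
  drop-contracts : ∀ k → drop (suc k) ≤ ratio * drop k
  drop-contracts k = *-cancelˡ Q+β>0 (begin
    (Q + β) * drop (suc k)           ≤⟨ ≤-by (0≤* (d≥0 k) (d≥0 (suc k))) (ℚ.*-distribʳ-+ (drop (suc k)) (Q + β) (drop k)) ⟩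
    (Q + β + drop k) * drop (suc k)  ≡⟨ drop-suc k ⟩
    β * drop k                       ≡⟨ cong (_* drop k) ratio-* ⟨
    (Q + β) * ratio * drop k         ≡⟨ ℚ.*-assoc (Q + β) ratio (drop k) ⟩
    (Q + β) * (ratio * drop k)       ∎)
    where open ℚ.≤-Reasoning

  drop-≤ : ∀ j k → drop (j ℕ.+ k) ≤ ratio ^ j * drop k
  drop-≤ zero    k = ℚ.≤-reflexive (sym (ℚ.*-identityˡ (drop k)))
  drop-≤ (suc j) k = begin
    drop (suc j ℕ.+ k)             ≤⟨ drop-contracts (j ℕ.+ k) ⟩
    ratio * drop (j ℕ.+ k)         ≤⟨ *-monoˡ ratio≥0 (drop-≤ j k) ⟩
    ratio * (ratio ^ j * drop k)   ≡⟨ ℚ.*-assoc ratio (ratio ^ j) (drop k) ⟨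
    ratio ^ suc j * drop k         ∎
    where open ℚ.≤-Reasoning

  drop-decreases : ∀ k → drop (suc k) ≤ drop k
  drop-decreases k = begin
    drop (suc k)     ≤⟨ drop-contracts k ⟩
    ratio * drop k   ≤⟨ *-monoʳ (d≥0 k) (ℚ.<⇒≤ ratio<1) ⟩
    1ℚ * drop k      ≡⟨ ℚ.*-identityˡ (drop k) ⟩
    drop k           ∎
    where open ℚ.≤-Reasoning

  drop-antitone : ∀ j k → drop (j ℕ.+ k) ≤ drop k
  drop-antitone zero    k = ℚ.≤-refl
  drop-antitone (suc j) k = ℚ.≤-trans (drop-decreases (j ℕ.+ k)) (drop-antitone j k)

  drop≤β : ∀ k → drop k ≤ β
  drop≤β k = subst₂ _≤_ (cong drop (ℕ.+-identityʳ k)) drop-zero (drop-antitone k 0)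

  drop-small : ∀ M → ∃ λ K → drop K * M ≤ 1ℚ
  drop-small M with ℚ.≤-total 0ℚ M
  ... | inj₂ M≤0 = 0 , (begin
    drop 0 * M     ≤⟨ *-monoˡ (d≥0 0) M≤0 ⟩
    drop 0 * 0ℚ    ≡⟨ ℚ.*-zeroʳ (drop 0) ⟩
    0ℚ             ≤⟨ 0≤1 ⟩
    1ℚ             ∎)
    where open ℚ.≤-Reasoning
  ... | inj₁ M≥0 = let K , p = power-vanishes ratio≥0 ratio<1 (β * M) in K , (begin
    drop K * M                   ≡⟨ cong (λ k → drop k * M) (ℕ.+-identityʳ K) ⟨
    drop (K ℕ.+ 0) * M           ≤⟨ *-monoʳ M≥0 (drop-≤ K 0) ⟩
    ratio ^ K * drop 0 * M       ≡⟨ cong (λ d → ratio ^ K * d * M) drop-zero ⟩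
    ratio ^ K * β * M            ≡⟨ ℚ.*-assoc (ratio ^ K) β M ⟩
    ratio ^ K * (β * M)          ≤⟨ p ⟩
    1ℚ                           ∎)
    where open ℚ.≤-Reasoning

  -- As `drop k` never exceeds β, the denominator of the recurrence is at most Q + 2 β, and
  -- consecutive terms have ratio at least β / (Q + 2 β). The factor 2 is consumed by
  -- `factor-ratio`.
  drop-ratio : ∃ λ N → ∀ k → 2ℚ * drop k ≤ fromℕ N * drop (suc k)
  drop-ratio =
    let N , p = archimedean β>0 (2ℚ * (Q + β + β)) in N , λ k → *-cancelˡ c>0 (begin
      c * (2ℚ * drop k)
        ≡⟨ solve 3 (λ t c d → c :* (t :* d) := t :* c :* d) refl 2ℚ c (drop k) ⟩
      2ℚ * c * drop k
        ≤⟨ *-monoʳ (d≥0 k) p ⟩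
      fromℕ N * β * drop k
        ≡⟨ trans (ℚ.*-assoc (fromℕ N) β (drop k)) (cong (fromℕ N *_) (sym (drop-suc k))) ⟩
      fromℕ N * ((Q + β + drop k) * drop (suc k))
        ≤⟨ *-monoˡ (0≤fromℕ N) (*-monoʳ (d≥0 (suc k)) (ℚ.+-monoʳ-≤ (Q + β) (drop≤β k))) ⟩
      fromℕ N * (c * drop (suc k))
        ≡⟨ solve 3 (λ n c d → n :* (c :* d) := c :* (n :* d)) refl (fromℕ N) c (drop (suc k)) ⟩
      c * (fromℕ N * drop (suc k)) ∎)
    where
    open ℚ.≤-Reasoning
    open +-*-Solver
    c = Q + β + β
    c>0 : 0ℚ < c
    c>0 = ℚ.+-mono-< Q+β>0 β>0

  -- For N d′ ≥ 2 d one has (1 - d′) ^ N (1 + 2 d) ≤ 1 by bernoulli⁻, and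
  -- 1 ≤ (1 - d) (1 + 2 d) as 2 d ≤ 1.

  factor-ratio : ∃ λ N → ∀ k → drop k * 2ℚ ≤ 1ℚ → (1ℚ - drop (suc k)) ^ N ≤ 1ℚ - drop k
  factor-ratio = let N , p = drop-ratio in N , λ k 2d≤1 →
    let d = drop k
        d′ = drop (suc k)
        X = (1ℚ - d′) ^ N
        d′≤1 = begin
          d′         ≤⟨ drop-decreases k ⟩
          d          ≤⟨ ≤-by (d≥0 k) (solve 1 (λ d → d :* con 2ℚ := d :+ d) refl d) ⟩
          d * 2ℚ     ≤⟨ 2d≤1 ⟩
          1ℚ         ∎
    in *-cancelʳ (ℚ.+-mono-<-≤ 0<1 (0≤* (ℚ.nonNegative⁻¹ 2ℚ) (d≥0 k))) (begin
      X * (1ℚ + 2ℚ * d)           ≤⟨ *-monoˡ (0≤^ (≤⇒0≤- d′≤1) N) (ℚ.+-monoʳ-≤ 1ℚ (p k)) ⟩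
      X * (1ℚ + fromℕ N * d′)     ≤⟨ bernoulli⁻ (d≥0 (suc k)) d′≤1 N ⟩
      1ℚ                          ≤⟨ ≤-by (0≤* (d≥0 k) (≤⇒0≤- 2d≤1))
                                       (solve 1 (λ d → (con 1ℚ :- d) :* (con 1ℚ :+ con 2ℚ :* d) :=
                                                       con 1ℚ :+ d :* (con 1ℚ :- d :* con 2ℚ)) refl d) ⟩
      (1ℚ - d) * (1ℚ + 2ℚ * d)    ∎)
    where
    open ℚ.≤-Reasoning
    open +-*-Solver

-- The greedy product

module Greedy (I : ℚ → ℕ → Set) (f : ℕ → ℚ) (c : ℕ → ℕ)
  (multiply : ∀ {Y S} k → I Y S → I (Y * f k) (S ℕ.+ c k))
  (c-mono : ∀ k → c k ℕ.≤ c (suc k))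
  where

  -- The greedy invariant: the product `Y` has not passed below the target `y`, but one more factor
  -- `f k` would take it there.
  Level : ℚ → ℕ → ℕ → Set
  Level y k bound = ∃ λ Y → ∃ λ S → I Y S × y ≤ Y × Y * f k < y × S ℕ.≤ bound

  -- `N` is the supply of factors. If it were exhausted, the last hypothesis would read `Y < y`,
  -- contrary to `y ≤ Y`, so the search stops earlier.
  level : ∀ {y S} k N Y → I Y S → y ≤ Y → Y * f k ^ N < y → Level y k (S ℕ.+ N ℕ.* c k)
  level k zero    Y i y≤Y Y<y = ⊥-elim (ℚ.<-irrefl refl (ℚ.≤-<-trans y≤Y (subst (_< _) (ℚ.*-identityʳ Y) Y<y)))
  level {y} {S} k (suc N) Y i y≤Y Y<y with Y * f k ℚ.<? y
  ... | yes Yf<y = Y , S , i , y≤Y , Yf<y , ℕ.m≤m+n S _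
  ... | no  Yf≮y =
    let Y′ , S′ , i′ , y≤Y′ , Y′f<y , S′≤ =
          level k N (Y * f k) (multiply k i) (ℚ.≮⇒≥ Yf≮y) (subst (_< y) (sym (ℚ.*-assoc Y (f k) (f k ^ N))) Y<y)
    in Y′ , S′ , i′ , y≤Y′ , Y′f<y , ℕ.≤-trans S′≤ (ℕ.≤-reflexive (ℕ.+-assoc S (c k) (N ℕ.* c k)))

  -- When level j stops, Y f(j) is below `y`, and f(j + 1) ^ N is at most f(j). So the same `N`
  -- suffices at every level. As the costs increase, j levels cost at most j N c(j).
  descend : ∀ {y A} N → (∀ k → f (suc k) ^ N ≤ f k) → 0ℚ ≤ y → Level y 0 A →
            ∀ j → Level y j (A ℕ.+ j ℕ.* (N ℕ.* c j))
  descend {A = A} N f^N≤f y≥0 top zero = let Y , S , i , p , r , S≤ = top in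
    Y , S , i , p , r , ℕ.≤-trans S≤ (ℕ.m≤m+n A 0)
  descend {A = A} N f^N≤f y≥0 top (suc j) =
    let Y , S , i , y≤Y , Yf<y , S≤ = descend N f^N≤f y≥0 top j
        Y′ , S′ , i′ , y≤Y′ , Y′f<y , S′≤ =
          level (suc j) N Y i y≤Y (ℚ.≤-<-trans (*-monoˡ (ℚ.≤-trans y≥0 y≤Y) (f^N≤f j)) Yf<y)
    in Y′ , S′ , i′ , y≤Y′ , Y′f<y , (begin
      S′                                                            ≤⟨ S′≤ ⟩
      S ℕ.+ N ℕ.* c (suc j)                                         ≤⟨ ℕ.+-monoˡ-≤ _ S≤ ⟩
      A ℕ.+ j ℕ.* (N ℕ.* c j) ℕ.+ N ℕ.* c (suc j)                   ≤⟨ ℕ.+-monoˡ-≤ _ (ℕ.+-monoʳ-≤ A (ℕ.*-monoʳ-≤ j (ℕ.*-monoʳ-≤ N (c-mono j)))) ⟩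
      A ℕ.+ j ℕ.* (N ℕ.* c (suc j)) ℕ.+ N ℕ.* c (suc j)             ≡⟨ trans (ℕ.+-assoc A _ _) (cong (ℕ._+_ A) (ℕ.+-comm (j ℕ.* (N ℕ.* c (suc j))) _)) ⟩
      A ℕ.+ suc j ℕ.* (N ℕ.* c (suc j))                             ∎)
    where open ℕ.≤-Reasoning

-- The cost 1 + 2 (m L + K) of the longest paths is at most m + 1 times its value `D` at m = 1. A
-- number of lengths linear in m, each of cost linear in m, makes the total quadratic.
size-bound : ∀ A N K L m →
  A ℕ.+ m ℕ.* L ℕ.* (N ℕ.* suc (2 ℕ.* (m ℕ.* L ℕ.+ K))) ℕ.+ suc (2 ℕ.* (m ℕ.* L ℕ.+ K)) ℕ.≤
  (A ℕ.+ L ℕ.* (N ℕ.* suc (2 ℕ.* (L ℕ.+ K))) ℕ.+ suc (2 ℕ.* (L ℕ.+ K))) ℕ.* (suc m ℕ.* suc m)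
size-bound A N K L m = begin
  A ℕ.+ m ℕ.* L ℕ.* (N ℕ.* c) ℕ.+ c
    ≤⟨ ℕ.+-mono-≤ (ℕ.+-mono-≤ A≤ (ℕ.*-mono-≤ (ℕ.*-monoˡ-≤ L (ℕ.n≤1+n m)) (ℕ.*-monoʳ-≤ N c≤)))
                  (ℕ.≤-trans c≤ (ℕ.*-monoʳ-≤ D (ℕ.m≤m*n M M))) ⟩
  A ℕ.* (M ℕ.* M) ℕ.+ M ℕ.* L ℕ.* (N ℕ.* (D ℕ.* M)) ℕ.+ D ℕ.* (M ℕ.* M)
    ≡⟨ solve 5 (λ A N L D M → A :* (M :* M) :+ M :* L :* (N :* (D :* M)) :+ D :* (M :* M) :=
                              (A :+ L :* (N :* D) :+ D) :* (M :* M)) refl A N L D M ⟩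
  (A ℕ.+ L ℕ.* (N ℕ.* D) ℕ.+ D) ℕ.* (M ℕ.* M) ∎
  where
  open ℕ.≤-Reasoning
  open ℕ.+-*-Solver
  M = suc m
  D = suc (2 ℕ.* (L ℕ.+ K))
  c = suc (2 ℕ.* (m ℕ.* L ℕ.+ K))
  A≤ : A ℕ.≤ A ℕ.* (M ℕ.* M)
  A≤ = ℕ.m≤m*n A (M ℕ.* M)
  c≤ : c ℕ.≤ D ℕ.* M
  c≤ = subst (c ℕ.≤_)
    (solve 3 (λ L K m → con 1 :+ con 2 :* (m :* L :+ K) :+ (m :+ con 2 :* K :* m :+ con 2 :* L) :=
                        (con 1 :+ con 2 :* (L :+ K)) :* (con 1 :+ m)) refl L K m)
    (ℕ.m≤m+n c _)

module _ {q α₁ α₂ : ℚ} {αs : List ℚ} (q<0 : q < 0ℚ) (α₂<0 : α₂ < 0ℚ)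
  (α₁∈ : α₁ ∈ αs) (α₂∈ : α₂ ∈ αs) (y₁²>1 : 1ℚ < (1ℚ + α₁) * (1ℚ + α₁)) where

  private
    y₁ = 1ℚ + α₁
    g  = y₁ * y₁
    q≢0 : q ≢ 0ℚ
    q≢0 = ℚ.<⇒≢ q<0

  implementable-even-power : ∀ a → ∃ λ S → Implementable q αs (g ^ suc a) S
  implementable-even-power zero = _ ,
    subst (λ y → Implementable q αs y 4) (sym (ℚ.*-identityʳ g))
      (implementable-edge α₁∈ (implementable-single q≢0 α₁∈))
  implementable-even-power (suc a) = let S , I = implementable-even-power a in _ ,
    subst (λ y → Implementable q αs y (suc (suc S)))
      (solve 2 (λ y p → p :* y :* y := y :* y :* p) refl y₁ (g ^ suc a))
      (implementable-edge α₁∈ (implementable-edge α₁∈ I))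
    where open +-*-Solver

  open PathBounds q<0 α₂<0

  -- `K`, `L`, `N` and the cost `A₀` of the first level are chosen before `m` and `y`, so the
  -- constant is uniform in both. Each further bit of precision takes `L` more lengths.
  approximable : ∀ B → ∃ λ C → ∀ m y → ½ ≤ y → y ≤ B →
    ∃ λ Y → ∃ λ S → Implementable q αs Y S × Y ≤ y × y ≤ Y + ½ ^ m × S ℕ.≤ C ℕ.* (suc m ℕ.* suc m)
  approximable B = A₀ ℕ.+ L ℕ.* (N ℕ.* c L) ℕ.+ c L , λ m y ½≤y y≤B →
    let y≥0 = ℚ.≤-trans (ℚ.nonNegative⁻¹ ½) ½≤y
        J = m ℕ.* L
        Y , S , I , y≤Y , Yf<y , S≤ = descend N f-ratio y≥0 (top y ½≤y y≤B) J
    -- The last factor is applied once more, to land just below `y`. Since y ≤ Y, the gap y - Y f(J)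
    -- is at most y - y f(J), that is `y` times the last drop.
    in Y * f J , S ℕ.+ c J , multiply J I , ℚ.<⇒≤ Yf<y ,
       (begin
         y                         ≡⟨ solve 2 (λ y d → y := y :* (con 1ℚ :- d) :+ y :* d) refl y (drop (J ℕ.+ K)) ⟩
         y * f J + y * drop (J ℕ.+ K)   ≤⟨ ℚ.+-mono-≤ (*-monoʳ (f≥0 J) y≤Y) (error m y y≥0 y≤B) ⟩
         Y * f J + ½ ^ m           ∎) ,
       ℕ.≤-trans (ℕ.+-monoˡ-≤ (c J) S≤) (size-bound A₀ N K L m)
    where
    open ℚ.≤-Reasoning
    open +-*-Solver
    -- The bound drop K * M ≤ 1 serves twice: the 2 keeps all drops at most ½, as `factor-ratio`
    -- demands, and `B` gives y * drop K ≤ 1, where the error estimate starts.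
    M = 2ℚ ⊔ B
    coarse = power-grows y₁²>1 B
    a = proj₁ coarse
    Y₀ = g ^ suc a
    S₀ = proj₁ (implementable-even-power a)
    K = proj₁ (drop-small M)
    N = proj₁ factor-ratio
    -- `L` further edges at least halve the drop.
    fine = power-vanishes ratio≥0 ratio<1 2ℚ
    L = proj₁ fine

    d≥0 : ∀ k → 0ℚ ≤ drop k
    d≥0 k = ℚ.<⇒≤ (drop-positive k)

    f : ℕ → ℚ
    f j = 1ℚ - drop (j ℕ.+ K)

    c : ℕ → ℕ
    c j = suc (2 ℕ.* (j ℕ.+ K))

    multiply : ∀ {Y S} k → Implementable q αs Y S → Implementable q αs (Y * f k) (S ℕ.+ c k)
    multiply {S = S} k I = subst (Implementable q αs _) (sym (ℕ.+-suc S _)) (implementable-path α₂∈ (k ℕ.+ K) I)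

    open Greedy (Implementable q αs) f c multiply (λ k → ℕ.s≤s (ℕ.*-monoʳ-≤ 2 (ℕ.n≤1+n (k ℕ.+ K))))

    drop≤½ : ∀ j → drop (j ℕ.+ K) * 2ℚ ≤ 1ℚ
    drop≤½ j = begin
      drop (j ℕ.+ K) * 2ℚ   ≤⟨ *-monoʳ (ℚ.nonNegative⁻¹ 2ℚ) (drop-antitone j K) ⟩
      drop K * 2ℚ           ≤⟨ *-monoˡ (d≥0 K) (ℚ.p≤p⊔q 2ℚ B) ⟩
      drop K * M            ≤⟨ proj₂ (drop-small M) ⟩
      1ℚ                    ∎

    f≥0 : ∀ j → 0ℚ ≤ f j
    f≥0 j = ≤⇒0≤- (begin
      drop (j ℕ.+ K)        ≤⟨ ≤-by (d≥0 (j ℕ.+ K)) (solve 1 (λ d → d :* con 2ℚ := d :+ d) refl (drop (j ℕ.+ K))) ⟩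
      drop (j ℕ.+ K) * 2ℚ   ≤⟨ drop≤½ j ⟩
      1ℚ                    ∎)

    f<1 : f 0 < 1ℚ
    f<1 = <-by (drop-positive K) (solve 1 (λ d → con 1ℚ := con 1ℚ :- d :+ d) refl (drop K))

    f-ratio : ∀ j → f (suc j) ^ N ≤ f j
    f-ratio j = proj₂ factor-ratio (j ℕ.+ K) (drop≤½ j)

    -- `N₀` factors take `Y₀` down to at most ¼, strictly below every admissible `y`, since these
    -- are at least ½. So one supply serves the first level for all targets.
    first = power-vanishes (f≥0 0) f<1 (4ℚ * Y₀)
    N₀ = proj₁ first
    A₀ = S₀ ℕ.+ N₀ ℕ.* c 0

    top : ∀ y → ½ ≤ y → y ≤ B → Level y 0 A₀
    top y ½≤y y≤B = level 0 N₀ Y₀ (proj₂ (implementable-even-power a)) (ℚ.≤-trans y≤B (proj₂ coarse))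
      (ℚ.*-cancelˡ-<-nonNeg 4ℚ (begin-strict
        4ℚ * (Y₀ * f 0 ^ N₀)   ≡⟨ solve 3 (λ k Y p → k :* (Y :* p) := p :* (k :* Y)) refl 4ℚ Y₀ (f 0 ^ N₀) ⟩
        f 0 ^ N₀ * (4ℚ * Y₀)   ≤⟨ proj₂ first ⟩
        1ℚ                     <⟨ <-by 0<1 refl ⟩
        4ℚ * ½                 ≤⟨ *-monoˡ (ℚ.nonNegative⁻¹ 4ℚ) ½≤y ⟩
        4ℚ * y                 ∎))

    ratio^L≤½ : ratio ^ L ≤ ½
    ratio^L≤½ = *-cancelʳ (ℚ.positive⁻¹ 2ℚ) (proj₂ fine)

    error : ∀ m y → 0ℚ ≤ y → y ≤ B → y * drop (m ℕ.* L ℕ.+ K) ≤ ½ ^ m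
    error m y y≥0 y≤B = begin
      y * drop (m ℕ.* L ℕ.+ K)             ≤⟨ *-monoˡ y≥0 (drop-≤ (m ℕ.* L) K) ⟩
      y * (ratio ^ (m ℕ.* L) * drop K)     ≡⟨ solve 3 (λ y r d → y :* (r :* d) := r :* (d :* y)) refl y (ratio ^ (m ℕ.* L)) (drop K) ⟩
      ratio ^ (m ℕ.* L) * (drop K * y)     ≤⟨ *-monoˡ r≥0 (*-monoˡ (d≥0 K) (ℚ.≤-trans y≤B (ℚ.p≤q⊔p 2ℚ B))) ⟩
      ratio ^ (m ℕ.* L) * (drop K * M)     ≤⟨ *-monoˡ r≥0 (proj₂ (drop-small M)) ⟩
      ratio ^ (m ℕ.* L) * 1ℚ               ≡⟨ ℚ.*-identityʳ _ ⟩
      ratio ^ (m ℕ.* L)                    ≡⟨ ^-* ratio m L ⟩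
      (ratio ^ L) ^ m                      ≤⟨ ^-monoˡ (0≤^ ratio≥0 L) ratio^L≤½ m ⟩
      ½ ^ m                                ∎
      where r≥0 = 0≤^ ratio≥0 (m ℕ.* L)

-- From reals to rational targets

x≤∣x∣ : ∀ x → x ≤ ∣ x ∣
x≤∣x∣ x with ℚ.≤-total 0ℚ x
... | inj₁ 0≤x = ℚ.≤-reflexive (sym (ℚ.0≤p⇒∣p∣≡p 0≤x))
... | inj₂ x≤0 = ℚ.≤-trans x≤0 (ℚ.0≤∣p∣ x)

approx-≤ : ∀ (x : ℝ) m n → approx x m ≤ approx x n + (1/suc m + 1/suc n)
approx-≤ x m n = ≤-by (≤⇒0≤- (ℚ.≤-trans (x≤∣x∣ _) (regular x m n)))
  (solve 3 (λ a b e → b :+ e := a :+ (e :- (a :- b))) refl (approx x m) (approx x n) (1/suc m + 1/suc n))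
  where open +-*-Solver

toℚᵘ-1/suc : ∀ n → toℚᵘ (1/suc n) ℚᵘ.≃ mkℚᵘ (+ 1) n
toℚᵘ-1/suc n = ℚ.toℚᵘ-fromℚᵘ (mkℚᵘ (+ 1) n)

1/suc-antitone : ∀ {m n} → m ℕ.≤ n → 1/suc n ≤ 1/suc m
1/suc-antitone {m} {n} m≤n = ℚ.toℚᵘ-cancel-≤ (begin
  toℚᵘ (1/suc n)   ≃⟨ toℚᵘ-1/suc n ⟩
  mkℚᵘ (+ 1) n     ≤⟨ ℚᵘ.*≤* (ℤ.*-monoˡ-≤-nonNeg (+ 1) (ℤ.+≤+ (ℕ.s≤s m≤n))) ⟩
  mkℚᵘ (+ 1) m     ≃⟨ toℚᵘ-1/suc m ⟨
  toℚᵘ (1/suc m)   ∎)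
  where open ℚᵘ.≤-Reasoning

1/suc-inverse : ∀ n → fromℕ (suc n) * 1/suc n ≡ 1ℚ
1/suc-inverse n = ℚ.toℚᵘ-injective (begin
  toℚᵘ (fromℕ (suc n) * 1/suc n)              ≈⟨ ℚ.toℚᵘ-homo-* (fromℕ (suc n)) (1/suc n) ⟩
  toℚᵘ (fromℕ (suc n)) ℚᵘ.* toℚᵘ (1/suc n)    ≈⟨ ℚᵘ.*-cong (toℚᵘ-fromℕ (suc n)) (toℚᵘ-1/suc n) ⟩
  mkℚᵘ (+ suc n) 0 ℚᵘ.* mkℚᵘ (+ 1) n          ≈⟨ ℚᵘ.*≡* (trans (ℤ.*-identityʳ _) (trans (ℤ.*-identityʳ _)
                                                   (trans (cong (λ k → + suc k) (sym (ℕ.+-identityʳ n))) (sym (ℤ.*-identityˡ _))))) ⟩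
  mkℚᵘ (+ 1) 0                                ∎)
  where open ℚᵘ.≃-Reasoning

0≤1/suc : ∀ n → 0ℚ ≤ 1/suc n
0≤1/suc n = ℚ.nonNegative⁻¹ (1/suc n) {{ℚ.normalize-nonNeg 1 (suc n)}}

0<1/suc : ∀ n → 0ℚ < 1/suc n
0<1/suc n = ℚ.positive⁻¹ (1/suc n) {{ℚ.normalize-pos 1 (suc n)}}

8ℚ ⅛ ¼ : ℚ
8ℚ = + 8 / 1
⅛ = + 1 / 8
¼ = + 1 / 4

1/suc-small : 0ℚ < x → ∃ λ M → 8ℚ * 1/suc M ≤ x
1/suc-small {x} x>0 = let M , 8≤Mx = archimedean x>0 8ℚ in M , (begin
  8ℚ * 1/suc M                    ≤⟨ *-monoʳ (0≤1/suc M) (ℚ.≤-trans 8≤Mx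
                                       (≤-by (ℚ.<⇒≤ x>0) (solve 2 (λ n x → (con 1ℚ :+ n) :* x := n :* x :+ x) refl (fromℕ M) x))) ⟩
  fromℕ (suc M) * x * 1/suc M     ≡⟨ solve 3 (λ n x u → n :* x :* u := n :* u :* x) refl (fromℕ (suc M)) x (1/suc M) ⟩
  fromℕ (suc M) * 1/suc M * x     ≡⟨ cong (_* x) (1/suc-inverse M) ⟩
  1ℚ * x                          ≡⟨ ℚ.*-identityˡ x ⟩
  x                               ∎)
  where
  open ℚ.≤-Reasoning
  open +-*-Solver

½^-antitone : ∀ {m n} → m ℕ.≤ n → ½ ^ n ≤ ½ ^ m
½^-antitone {m} {n} m≤n with k , refl ← ℕ.m≤n⇒∃[o]m+o≡n m≤n = begin
  ½ ^ (m ℕ.+ k)      ≡⟨ ^-+ ½ m k ⟩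
  ½ ^ m * ½ ^ k      ≤⟨ *-monoˡ (0≤^ (ℚ.nonNegative⁻¹ ½) m) (½^≤1 k) ⟩
  ½ ^ m * 1ℚ         ≡⟨ ℚ.*-identityʳ (½ ^ m) ⟩
  ½ ^ m              ∎
  where
  open ℚ.≤-Reasoning
  ½^≤1 : ∀ k → ½ ^ k ≤ 1ℚ
  ½^≤1 zero    = ℚ.≤-refl
  ½^≤1 (suc k) = ℚ.≤-trans (*-monoˡ (ℚ.nonNegative⁻¹ ½) (½^≤1 k)) (toWitness {a? = ½ * 1ℚ ℚ.≤? 1ℚ} _)

-- The exponent is lowered until its predecessor fails. If ½ ^ n ≤ 2 x, then 4 ½ ^ (n + 3) = ½ ½ ^ n
-- ≤ x, so the predecessor of m, having failed, is smaller than n + 3.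
log₂-approximation : 0ℚ < x → ∃ λ m → 4ℚ * ½ ^ m ≤ x × ∀ n → ½ ^ n ≤ x + x → m ℕ.≤ 3 ℕ.+ n
log₂-approximation {x} x>0 = let m , p = exponent in least m p
  where
  open ℚ.≤-Reasoning
  open +-*-Solver
  instance
    _ = ℚ.positive x>0
    _ = ℚ.pos⇒nonZero x

  exponent : ∃ λ m → 4ℚ * ½ ^ m ≤ x
  exponent = let m , p = power-vanishes {½} (ℚ.nonNegative⁻¹ ½) (toWitness {a? = ½ ℚ.<? 1ℚ} _) (4ℚ * 1/ x) in m , (begin
    4ℚ * ½ ^ m                        ≡⟨ ℚ.*-identityʳ _ ⟨
    4ℚ * ½ ^ m * 1ℚ                   ≡⟨ cong (4ℚ * ½ ^ m *_) (ℚ.*-inverseˡ x) ⟨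
    4ℚ * ½ ^ m * (1/ x * x)           ≡⟨ solve 4 (λ f p i x → f :* p :* (i :* x) := p :* (f :* i) :* x) refl 4ℚ (½ ^ m) (1/ x) x ⟩
    ½ ^ m * (4ℚ * 1/ x) * x           ≤⟨ *-monoʳ (ℚ.<⇒≤ x>0) p ⟩
    1ℚ * x                            ≡⟨ ℚ.*-identityˡ x ⟩
    x                                 ∎)

  least : ∀ m → 4ℚ * ½ ^ m ≤ x → ∃ λ m → 4ℚ * ½ ^ m ≤ x × ∀ n → ½ ^ n ≤ x + x → m ℕ.≤ 3 ℕ.+ n
  least zero    p = zero , p , λ _ _ → ℕ.z≤n
  least (suc m) p with 4ℚ * ½ ^ m ℚ.≤? x
  ... | yes p′ = least m p′
  ... | no ¬p  = suc m , p , λ n ½^n≤2x → ℕ.≰⇒> λ 3+n≤m → ¬p (begin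
    4ℚ * ½ ^ m                      ≤⟨ *-monoˡ (ℚ.nonNegative⁻¹ 4ℚ) (½^-antitone 3+n≤m) ⟩
    4ℚ * (½ * (½ * (½ * ½ ^ n)))    ≡⟨ solve 1 (λ p → con 4ℚ :* (con ½ :* (con ½ :* (con ½ :* p))) := con ½ :* p) refl (½ ^ n) ⟩
    ½ * ½ ^ n                       ≤⟨ *-monoˡ (ℚ.nonNegative⁻¹ ½) ½^n≤2x ⟩
    ½ * (x + x)                     ≡⟨ solve 1 (λ x → con ½ :* (x :+ x) := x) refl x ⟩
    x                               ∎)

-- (1 + α)² - 1 = α (α + 2), and outside [-2, 0] both factors have the same sign.
y²>1 : ∀ {α} → ¬ (-[1+ 1 ] / 1 ≤ α × α ≤ 0ℚ) → 1ℚ < (1ℚ + α) * (1ℚ + α)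
y²>1 {α} α∉ with -[1+ 1 ] / 1 ℚ.≤? α | α ℚ.≤? 0ℚ
... | yes p | yes q = ⊥-elim (α∉ (p , q))
... | no α≱-2 | _ = <-by (0<* (<⇒0<- (ℚ.≰⇒> α≱-2)) (<⇒0<- (ℚ.<-trans (ℚ.≰⇒> α≱-2) (toWitness {a? = -[1+ 1 ] / 1 ℚ.<? 0ℚ} _))))
  (solve 1 (λ α → (con 1ℚ :+ α) :* (con 1ℚ :+ α) := con 1ℚ :+ (con (-[1+ 1 ] / 1) :- α) :* (con 0ℚ :- α)) refl α)
  where open +-*-Solver
... | yes _ | no α≰0 = <-by (0<* (ℚ.≰⇒> α≰0) (ℚ.+-mono-< (ℚ.≰⇒> α≰0) (ℚ.positive⁻¹ 2ℚ)))
  (solve 1 (λ α → (con 1ℚ :+ α) :* (con 1ℚ :+ α) := con 1ℚ :+ α :* (α :+ con 2ℚ)) refl α)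
  where open +-*-Solver

-- The coefficients of C (4 + n)².
quadratic : ℕ → Polynomial
quadratic C = 16 ℕ.* C ∷ 8 ℕ.* C ∷ C ∷ []

quadratic-bound : ∀ C {m n} → m ℕ.≤ 3 ℕ.+ n → C ℕ.* (suc m ℕ.* suc m) ℕ.≤ eval (quadratic C) n
quadratic-bound C {m} {n} m≤3+n = begin
  C ℕ.* (suc m ℕ.* suc m)               ≤⟨ ℕ.*-monoʳ-≤ C (ℕ.*-mono-≤ (ℕ.s≤s m≤3+n) (ℕ.s≤s m≤3+n)) ⟩
  C ℕ.* ((4 ℕ.+ n) ℕ.* (4 ℕ.+ n))       ≡⟨ solve 2 (λ C n → C :* ((con 4 :+ n) :* (con 4 :+ n)) :=
                                              con 16 :* C :+ n :* (con 8 :* C :+ n :* (C :+ n :* con 0))) refl C n ⟩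
  eval (quadratic C) n                  ∎
  where
  open ℕ.≤-Reasoning
  open ℕ.+-*-Solver

-- With ρ, target and τ as below, ρ / 2 ≤ π, target ≤ T* ≤ target + 2 τ and
-- τ ≤ ρ / 16, which leaves room for an error of ρ / 4 below the target.

module Target {T⁻ T⁺ T* π : ℝ} (0<T⁻ : fromℚ 0ℚ <ᴿ T⁻) (T⁻≤T* : T⁻ ≤ᴿ T*) (T*≤T⁺ : T* ≤ᴿ T⁺)
  (0<π : fromℚ 0ℚ <ᴿ π) where

  open ℚ.≤-Reasoning
  open +-*-Solver

  private
    n₀ = proj₁ 0<π
    u = 1/suc n₀

  ρ : ℚ
  ρ = approx π n₀

  private
    2u<ρ : u + u < ρ
    2u<ρ = subst (_< ρ) (ℚ.+-identityˡ (u + u)) (proj₂ 0<π)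

  0<ρ : 0ℚ < ρ
  0<ρ = ℚ.<-trans (ℚ.+-mono-< (0<1/suc n₀) (0<1/suc n₀)) 2u<ρ

  private
    M = proj₁ (1/suc-small (0<1/suc n₀))
    τ = 1/suc M
    8τ≤u : 8ℚ * τ ≤ u
    8τ≤u = proj₂ (1/suc-small (0<1/suc n₀))
    8τ≤1 : 8ℚ * τ ≤ 1ℚ
    8τ≤1 = ℚ.≤-trans 8τ≤u (1/suc-antitone (ℕ.z≤n {n₀}))
    a = approx T* M

  target : ℚ
  target = a - τ

  private
    0≤a+3τ : 0ℚ ≤ a + (τ + τ + τ)
    0≤a+3τ = ≤-by (0≤+ (0≤+ (ℚ.<⇒≤ (0<1/suc l)) (≤⇒0≤- (ℚ.<⇒≤ (proj₂ 0<T⁻))))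
                       (0≤+ (≤⇒0≤- (approx-≤ T⁻ l M)) (≤⇒0≤- (T⁻≤T* M))))
      (solve 5 (λ a t v x y → a :+ (t :+ t :+ t) := con 0ℚ :+
        ((v :+ (x :- (con 0ℚ :+ (v :+ v)))) :+ ((y :+ (v :+ t) :- x) :+ (a :+ (t :+ t) :- y))))
        refl a τ v (approx T⁻ l) (approx T⁻ M))
      where
      l = proj₁ 0<T⁻
      v = 1/suc l

  -- Sampling positivity of T⁻ at precision τ only yields a ≥ - 3 τ. Hence 1 + target ≥ 1 - 4 τ,
  -- which is at least ½ as 8 τ ≤ 1.
  ½≤1+target : ½ ≤ 1ℚ + target
  ½≤1+target = ≤-by (0≤+ (0≤* (ℚ.nonNegative⁻¹ ½) (≤⇒0≤- 8τ≤1)) 0≤a+3τ)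
    (solve 2 (λ a t → con 1ℚ :+ (a :- t) := con ½ :+ (con ½ :* (con 1ℚ :- con 8ℚ :* t) :+ (a :+ (t :+ t :+ t)))) refl a τ)

  -- The sample of T⁺ at index 0 is off by at most 1, and the remaining errors stay well within the
  -- constant 4. This bound involves neither T* nor π.
  1+target≤ : 1ℚ + target ≤ approx T⁺ 0 + 4ℚ
  1+target≤ = ≤-by (0≤+ (0≤+ (≤⇒0≤- (T*≤T⁺ M)) (≤⇒0≤- (approx-≤ T⁺ M 0)))
                        (0≤+ (0≤* (ℚ.nonNegative⁻¹ ¼) (≤⇒0≤- 8τ≤1)) (ℚ.nonNegative⁻¹ (+ 7 / 4))))
    (solve 4 (λ a t x y → y :+ con 4ℚ := con 1ℚ :+ (a :- t) :+
        ((x :+ (t :+ t) :- a) :+ (y :+ (t :+ con 1ℚ) :- x) :+ (con ¼ :* (con 1ℚ :- con 8ℚ :* t) :+ con (+ 7 / 4))))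
      refl a τ (approx T⁺ M) (approx T⁺ 0))

  target≤ : ∀ k → target ≤ approx T* k + 1/suc k
  target≤ k = ≤-by (≤⇒0≤- (approx-≤ T* M k))
    (solve 4 (λ a t x v → x :+ v := (a :- t) :+ (x :+ (t :+ v) :- a)) refl a τ (approx T* k) (1/suc k))

  upper : ∀ Y → Y ≤ 1ℚ + target → fromℚ (Y - 1ℚ) ≤ᴿ T*
  upper Y Y≤ k = ≤-by (0≤+ (0≤+ (≤⇒0≤- Y≤) (≤⇒0≤- (target≤ k))) (0≤1/suc k))
    (solve 4 (λ Y r x v → x :+ (v :+ v) := (Y :- con 1ℚ) :+ ((con 1ℚ :+ r :- Y) :+ (x :+ v :- r) :+ v))
      refl Y target (approx T* k) (1/suc k))

  -- Apart from sampling at `k₂`, the errors amount to 2 τ + u + ε. By 8 τ ≤ u, 2 u < ρ and 4 ε ≤ ρ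
  -- this is at most 5 u / 4 + ρ / 4 ≤ 7 ρ / 8; the last summand ρ / 8 is what is left over. The two
  -- errors 1 / (k₂ + 1) fit into the tolerance of `≤ᴿ` at `k`.
  lower : ∀ Y ε → 1ℚ + target ≤ Y + ε → 4ℚ * ε ≤ ρ → T* -ᴿ π ≤ᴿ fromℚ (Y - 1ℚ)
  lower Y ε ≤Y+ε 4ε≤ρ k = ≤-by
    (0≤+ (0≤+ (0≤+ (≤⇒0≤- (approx-≤ T* k₂ M)) (≤⇒0≤- (approx-≤ π n₀ k₂))) (≤⇒0≤- ≤Y+ε))
         (0≤+ (0≤+ (0≤* (ℚ.nonNegative⁻¹ 2ℚ) (≤⇒0≤- (1/suc-antitone k≤k₂))) (0≤* (ℚ.nonNegative⁻¹ ¼) (≤⇒0≤- 4ε≤ρ)))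
              (0≤+ (0≤* (ℚ.nonNegative⁻¹ ¼) (≤⇒0≤- 8τ≤u))
                   (0≤+ (0≤* (ℚ.nonNegative⁻¹ (+ 5 / 8)) (≤⇒0≤- (ℚ.<⇒≤ 2u<ρ)))
                        (0≤* (ℚ.nonNegative⁻¹ ⅛) (ℚ.<⇒≤ 0<ρ))))))
    (solve 10 (λ a b p r t u v v₂ Y e →
        (Y :- con 1ℚ) :+ (v :+ v) :=
        (b :- p) :+ (((a :+ (v₂ :+ t) :- b) :+ (p :+ (u :+ v₂) :- r) :+ (Y :+ e :- (con 1ℚ :+ (a :- t)))) :+
          ((con 2ℚ :* (v :- v₂) :+ con ¼ :* (r :- con 4ℚ :* e)) :+
           (con ¼ :* (u :- con 8ℚ :* t) :+ (con (+ 5 / 8) :* (r :- (u :+ u)) :+ con ⅛ :* r)))))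
      refl a (approx T* k₂) (approx π k₂) ρ τ u (1/suc k) (1/suc k₂) Y ε)
    where
    k₂ = suc (k ℕ.+ k)
    k≤k₂ : k ℕ.≤ k₂
    k≤k₂ = ℕ.m≤n⇒m≤1+n (ℕ.m≤m+n k k)

  -- Reading the hypothesis at index `n₀` costs 2 u, which is below ρ.
  log₂≤ : ∀ {k} → log₂[ π ⁻¹]≤ k → ½ ^ k ≤ ρ + ρ
  log₂≤ ½^k≤π = ℚ.≤-trans (½^k≤π n₀) (ℚ.+-monoʳ-≤ ρ (ℚ.<⇒≤ 2u<ρ))

lemma11 : (q α₁ α₂ α₃ : ℚ) →
    q < 0ℚ →
    ¬ (-[1+ 1 ] / 1 ≤ α₁ × α₁ ≤ 0ℚ) →
    -[1+ 1 ] / 1 < α₂ × α₂ < 0ℚ →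
    α₃ < -[1+ 0 ] / 1 →
    (T⁻ T⁺ : ℝ) →
    fromℚ 0ℚ <ᴿ T⁻ →
    T⁻ ≤ᴿ T⁺ →
    Σ Polynomial λ p →
    Σ ℝ λ π₀ → fromℚ 0ℚ <ᴿ π₀ ×
    ((T* π : ℝ) →
    T⁻ ≤ᴿ T* → T* ≤ᴿ T⁺ →
    fromℚ 0ℚ <ᴿ π → π ≤ᴿ π₀ →
    Σ Graph λ Υ →
    Σ (Graph.Vertex Υ) λ s →
    Σ (Graph.Vertex Υ) λ t →
    Σ (Graph.Edge Υ → ℚ) λ ŵ →
    Σ ℚ λ w* →
    PlanarWithTerminals Υ s t ×
    (∀ e → ŵ e ∈ α₁ ∷ α₂ ∷ α₃ ∷ []) ×
    Implements q Υ ŵ s t w* ×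
    T* -ᴿ π ≤ᴿ fromℚ w* ×
    fromℚ w* ≤ᴿ T* ×
    (∀ n → log₂[ π ⁻¹]≤ n → size Υ ℕ.≤ eval p n))
lemma11 q α₁ α₂ α₃ q<0 α₁∉ (_ , α₂<0) _ T⁻ T⁺ 0<T⁻ _ =
  -- The bound on y comes from T⁺ alone, so `C`, and with it the polynomial, is fixed before T* and
  -- π are given.
  let C , approximate = approximable {αs = α₁ ∷ α₂ ∷ α₃ ∷ []} q<0 α₂<0 (here refl) (there (here refl)) (y²>1 α₁∉) (approx T⁺ 0 + 4ℚ)
  -- Index 2 witnesses 0 < 1, as 1/3 + 1/3 < 1.
  in quadratic C , fromℚ 1ℚ , (2 , toWitness {a? = 0ℚ + (1/suc 2 + 1/suc 2) ℚ.<? 1ℚ} _) ,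
  λ T* π T⁻≤T* T*≤T⁺ 0<π _ →
  let open Target {T⁻} {T⁺} {T*} {π} 0<T⁻ T⁻≤T* T*≤T⁺ 0<π
      m , 4ε≤ρ , m≤ = log₂-approximation 0<ρ
      Y , S , I , Y≤ , ≤Y+ε , S≤ = approximate m (1ℚ + target) ½≤1+target 1+target≤
      Υ , s , t , ŵ , planar , weights , implements , size≡ = implementable⇒implements I
  in Υ , s , t , ŵ , Y - 1ℚ , planar , weights , implements ,
     lower Y (½ ^ m) ≤Y+ε 4ε≤ρ , upper Y Y≤ ,
     λ n log≤n → subst (ℕ._≤ eval (quadratic C) n) (sym size≡)
                   (ℕ.≤-trans S≤ (quadratic-bound C (m≤ n (log₂≤ {n} log≤n))))
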